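{- Let $n\ge 2$ be an integer and let $\nu\in\{1,2,\ldots,n-1\}$. Put $C_n(\nu)=\sum_{l=1}^{n-1}\cos\frac{2\pi\nu l}{n}\csc\frac{\pi l}{n}$ and $S_n=\sum_{l=1}^{n-1}\csc\frac{\pi l}{n}$. Then the following four identities hold: $$C_n(\nu)=S_n-2\sum_{l=1}^{\nu}\cot\frac{(2l-1)\pi}{2n},$$ $$C_n(\nu)=S_n-2\sum_{l=1}^{n-1}\sin^2\frac{\pi\nu l}{n}\cdot\csc\frac{\pi l}{n},$$ $$C_n(\nu)=-S_n+2\sum_{l=1}^{n-1}\cos^2\frac{\pi\nu l}{n}\cdot\csc\frac{\pi l}{n},$$ $$C_n(\nu)=S_n-\cot\frac{\pi}{2n}+\cot\frac{\pi(2\nu+1)}{2n}-2\sum_{l=1}^{n-1}\cot\frac{\pi l}{n}\cdot\sin\frac{\pi l\nu}{n}\cdot\sin\frac{\pi l(\nu+1)}{n}.$$ -}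

module Defs where

open import Data.Nat.Base as ℕ using (ℕ; zero; suc; z≤n; s≤s; _!)
open import Data.Nat.Properties as ℕₚ using (_!≢0)
open import Data.Integer.Base as ℤ using (+_)
import Data.Rational.Properties as ℚₚ
import Data.Integer.Properties as ℤₚ
open import Data.Rational.Base using (ℚ; 0ℚ; 1ℚ; ½; _/_; toℚᵘ; NonZero; ≢-nonZero; positive; nonNegative; +-*-rawSemiring)
open import Data.Rational.Base as ℚ using (*≤*)
import Data.Rational.Unnormalised.Base as ℚᵘ
import Data.Rational.Unnormalised.Properties as ℚᵘₚ
open import Data.Product.Base using (∃; _,_; _×_; proj₁; proj₂; Σ-syntax)
open import Data.Sum.Base using (inj₁; inj₂)
open import Data.Empty using (⊥; ⊥-elim)
open import Relation.Nullary using (yes; no)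
open import Relation.Binary.PropositionalEquality

module Rational where
  open import Data.Rational.Base using (_+_; _*_; _-_; -_; _≤_; _<_; ∣_∣)
  open import Data.Rational.Properties
  open import Data.Rational.Solver using (module +-*-Solver)
  open +-*-Solver
  open import Algebra.Definitions.RawSemiring +-*-rawSemiring public using (_^_)

  ι : ℕ → ℚ
  ι n = + n / 1

  1/!_ : ℕ → ℚ
  1/! n = (+ 1 / n !) {{n !≢0}}

  ∑± : (ℕ → ℚ) → ℕ → ℚ
  ∑± s zero    = 0ℚ
  ∑± s (suc n) = ∑± s n + (- 1ℚ) ^ n * s n

  inv : ℚ → ℚ
  inv p with p ≟ 0ℚ
  ... | yes _   = 0ℚ
  ... | no p≢0 = (ℚ.1/ p) {{≢-nonZero p≢0}}

  Cauchy : (ℕ → ℚ) → Set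
  Cauchy x = ∀ ε → 0ℚ < ε → ∃ λ N → ∀ {m n} → N ℕ.≤ m → N ℕ.≤ n → ∣ x m - x n ∣ < ε

  q : ℚ
  q = + 9 / 10

  abstract
    ≤-diff : ∀ {a b} d → 0ℚ ≤ d → a + d ≡ b → a ≤ b
    ≤-diff {a} d 0≤d refl = subst (_≤ a + d) (+-identityʳ a) (+-monoʳ-≤ a 0≤d)

    *-monoʳ : ∀ {r a b} → 0ℚ ≤ r → a ≤ b → r * a ≤ r * b
    *-monoʳ {r} 0≤r = *-monoˡ-≤-nonNeg r {{nonNegative 0≤r}}

    *-monoˡ : ∀ {r a b} → 0ℚ ≤ r → a ≤ b → a * r ≤ b * r
    *-monoˡ {r} 0≤r = *-monoʳ-≤-nonNeg r {{nonNegative 0≤r}}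

    0≤+ : ∀ {a b} → 0ℚ ≤ a → 0ℚ ≤ b → 0ℚ ≤ a + b
    0≤+ = +-mono-≤

    0≤* : ∀ {a b} → 0ℚ ≤ a → 0ℚ ≤ b → 0ℚ ≤ a * b
    0≤* {a} {b} 0≤a 0≤b = subst (_≤ a * b) (*-zeroʳ a) (*-monoʳ 0≤a 0≤b)

    *-mono : ∀ {a b c d} → 0ℚ ≤ b → 0ℚ ≤ c → a ≤ b → c ≤ d → a * c ≤ b * d
    *-mono 0≤b 0≤c a≤b c≤d = ≤-trans (*-monoˡ 0≤c a≤b) (*-monoʳ 0≤b c≤d)

    0<* : ∀ {a b} → 0ℚ < a → 0ℚ < b → 0ℚ < a * b
    0<* {a} {b} 0<a 0<b = subst (_< a * b) (*-zeroʳ a) (*-monoʳ-<-pos a {{positive 0<a}} 0<b)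

    0≤b-a : ∀ {a b} → a ≤ b → 0ℚ ≤ b - a
    0≤b-a {a} {b} a≤b = subst (_≤ b - a) (+-inverseʳ a) (+-monoˡ-≤ (- a) a≤b)

    p≤∣p∣ : ∀ p → p ≤ ∣ p ∣
    p≤∣p∣ p with ≤-total 0ℚ p
    ... | inj₁ 0≤p = ≤-reflexive (sym (0≤p⇒∣p∣≡p 0≤p))
    ... | inj₂ p≤0 = ≤-trans p≤0 (0≤∣p∣ p)

    ∣p∣≤ : ∀ {p b} → p ≤ b → - p ≤ b → ∣ p ∣ ≤ b
    ∣p∣≤ {p} {b} p≤b -p≤b with ∣p∣≡p∨∣p∣≡-p p
    ... | inj₁ eq = subst (_≤ b) (sym eq) p≤b
    ... | inj₂ eq = subst (_≤ b) (sym eq) -p≤b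

    ∣-∣-sym : ∀ a b → ∣ a - b ∣ ≡ ∣ b - a ∣
    ∣-∣-sym a b = trans (cong ∣_∣ (solve 2 (λ a b → a :- b := :- (b :- a)) refl a b)) (∣-p∣≡∣p∣ (b - a))

    triangle : ∀ a b c → ∣ a - c ∣ ≤ ∣ a - b ∣ + ∣ b - c ∣
    triangle a b c = subst (λ t → ∣ t ∣ ≤ ∣ a - b ∣ + ∣ b - c ∣)
      (solve 3 (λ a b c → (a :- b) :+ (b :- c) := a :- c) refl a b c) (∣p+q∣≤∣p∣+∣q∣ (a - b) (b - c))

    ∣p∣≤∣p-r∣+∣r∣ : ∀ p r → ∣ p ∣ ≤ ∣ p - r ∣ + ∣ r ∣
    ∣p∣≤∣p-r∣+∣r∣ p r = subst (λ t → ∣ t ∣ ≤ ∣ p - r ∣ + ∣ r ∣)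
      (solve 2 (λ p r → (p :- r) :+ r := p) refl p r) (∣p+q∣≤∣p∣+∣q∣ (p - r) r)

    half+half : ∀ ε → ½ * ε + ½ * ε ≡ ε
    half+half ε = solve 1 (λ e → con ½ :* e :+ con ½ :* e := e) refl ε

    0<½* : ∀ {ε} → 0ℚ < ε → 0ℚ < ½ * ε
    0<½* = 0<* (positive⁻¹ ½)

    ι-≃ : ∀ n → toℚᵘ (ι n) ℚᵘ.≃ (+ n) ℚᵘ./ 1
    ι-≃ n = toℚᵘ-fromℚᵘ (ℚᵘ.mkℚᵘ (+ n) 0)

    0≤ι : ∀ n → 0ℚ ≤ ι n
    0≤ι n = nonNegative⁻¹ (ι n) {{normalize-nonNeg n 1}}

    ι-suc : ∀ n → ι (suc n) ≡ 1ℚ + ι n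
    ι-suc n = toℚᵘ-injective (ℚᵘₚ.≃-trans (ι-≃ (suc n)) (ℚᵘₚ.≃-sym
      (ℚᵘₚ.≃-trans (toℚᵘ-homo-+ 1ℚ (ι n)) (ℚᵘₚ.≃-trans (ℚᵘₚ.+-congʳ ℚᵘ.1ℚᵘ (ι-≃ n)) (ℚᵘ.*≡* eq)))))
      where
        eq : ((+ 1) ℤ.* (+ 1) ℤ.+ (+ n) ℤ.* (+ 1)) ℤ.* (+ 1) ≡ (+ suc n) ℤ.* (+ 1)
        eq = cong (ℤ._* (+ 1)) (cong (λ i → (+ 1) ℤ.+ i) (ℤₚ.*-identityʳ (+ n)))

    0<ι : ∀ n → 0ℚ < ι (suc n)
    0<ι n = subst (0ℚ <_) (sym (ι-suc n)) (+-mono-<-≤ (positive⁻¹ 1ℚ) (0≤ι n))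

    ι-mono : ∀ {m n} → m ℕ.≤ n → ι m ≤ ι n
    ι-mono {n = n} z≤n = 0≤ι n
    ι-mono (s≤s {m} {n} m≤n) = subst₂ _≤_ (sym (ι-suc m)) (sym (ι-suc n)) (+-monoʳ-≤ 1ℚ (ι-mono m≤n))

    archimedean : ∀ p → ∃ λ n → p ≤ ι n
    archimedean p@(ℚ.mkℚ i d-1 _) = ℤ.∣ i ∣ , toℚᵘ-cancel-≤
      (ℚᵘₚ.≤-respʳ-≃ (ℚᵘₚ.≃-sym (ι-≃ ℤ.∣ i ∣)) (ℚᵘ.*≤* ineq))
      where
        i≤ : ∀ i → i ℤ.≤ + ℤ.∣ i ∣
        i≤ (+ n) = ℤₚ.≤-refl
        i≤ (ℤ.-[1+ n ]) = ℤ.-≤+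
        ineq : i ℤ.* (+ 1) ℤ.≤ (+ ℤ.∣ i ∣) ℤ.* (+ suc d-1)
        ineq = ℤₚ.≤-trans (ℤₚ.≤-reflexive (ℤₚ.*-identityʳ i)) (ℤₚ.≤-trans (i≤ i)
          (subst (λ j → (+ ℤ.∣ i ∣) ℤ.≤ j) (ℤₚ.pos-* ℤ.∣ i ∣ (suc d-1)) (ℤ.+≤+ (ℕₚ.m≤m*n ℤ.∣ i ∣ (suc d-1)))))

    recip : ∀ p → 0ℚ < p → ∃ λ r → (0ℚ < r) × (r * p ≡ 1ℚ)
    recip p 0<p = (ℚ.1/ p) {{nz}} , positive⁻¹ ((ℚ.1/ p) {{nz}}) {{1/pos⇒pos p {{positive 0<p}}}} , *-inverseˡ p {{nz}}
      where
        nz : NonZero p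
        nz = pos⇒nonZero p {{positive 0<p}}

    1/!-suc : ∀ n → 1/! (suc n) * ι (suc n) ≡ 1/! n
    1/!-suc n = lem (suc n) (n !) {{suc n !≢0}} {{n !≢0}}
      where
        open ℚᵘₚ.≃-Reasoning
        /-≃ : ∀ i b .{{_ : ℕ.NonZero b}} → toℚᵘ (i / b) ℚᵘ.≃ i ℚᵘ./ b
        /-≃ i (suc b) = toℚᵘ-fromℚᵘ (ℚᵘ.mkℚᵘ i b)
        lem : ∀ a b .{{_ : ℕ.NonZero (a ℕ.* b)}} .{{_ : ℕ.NonZero b}} → (+ 1 / (a ℕ.* b)) * ι a ≡ (+ 1) / b
        lem zero b {{()}}
        lem a@(suc _) b@(suc _) = toℚᵘ-injective (begin
          toℚᵘ ((+ 1 / (a ℕ.* b)) * ι a)            ≈⟨ toℚᵘ-homo-* (+ 1 / (a ℕ.* b)) (ι a) ⟩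
          toℚᵘ (+ 1 / (a ℕ.* b)) ℚᵘ.* toℚᵘ (ι a)    ≈⟨ ℚᵘₚ.*-cong (/-≃ (+ 1) (a ℕ.* b)) (ι-≃ a) ⟩
          ((+ 1) ℚᵘ./ (a ℕ.* b)) ℚᵘ.* ((+ a) ℚᵘ./ 1) ≈⟨ ℚᵘ.*≡* eq ⟩
          (+ 1) ℚᵘ./ b                             ≈⟨ /-≃ (+ 1) b ⟨
          toℚᵘ (+ 1 / b) ∎)
          where
            eq : ((+ 1) ℤ.* (+ a)) ℤ.* (+ b) ≡ (+ 1) ℤ.* ((+ (a ℕ.* b)) ℤ.* (+ 1))
            eq = trans (cong (ℤ._* (+ b)) (ℤₚ.*-identityˡ (+ a))) (trans (sym (ℤₚ.pos-* a b))
              (sym (trans (ℤₚ.*-identityˡ _) (ℤₚ.*-identityʳ _))))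

    0≤1/! : ∀ n → 0ℚ ≤ 1/! n
    0≤1/! n = nonNegative⁻¹ (1/! n) {{normalize-nonNeg 1 (n !) {{n !≢0}}}}

    0≤^ : ∀ {z} n → 0ℚ ≤ z → 0ℚ ≤ z ^ n
    0≤^ zero    _   = nonNegative⁻¹ 1ℚ
    0≤^ (suc n) 0≤z = 0≤* 0≤z (0≤^ n 0≤z)

    ^-mono : ∀ {y z} n → 0ℚ ≤ y → y ≤ z → y ^ n ≤ z ^ n
    ^-mono zero    _   _   = ≤-refl
    ^-mono (suc n) 0≤y y≤z = *-mono (≤-trans 0≤y y≤z) (0≤^ n 0≤y) y≤z (^-mono n 0≤y y≤z)

    ∣^∣ : ∀ z n → ∣ z ^ n ∣ ≡ ∣ z ∣ ^ n
    ∣^∣ z zero    = refl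
    ∣^∣ z (suc n) = trans (∣p*q∣≡∣p∣*∣q∣ z (z ^ n)) (cong (∣ z ∣ *_) (∣^∣ z n))

    1^ : ∀ n → 1ℚ ^ n ≡ 1ℚ
    1^ zero = refl
    1^ (suc n) = trans (*-identityˡ _) (1^ n)

    ∣±∣ : ∀ n p → ∣ (- 1ℚ) ^ n * p ∣ ≡ ∣ p ∣
    ∣±∣ n p = trans (∣p*q∣≡∣p∣*∣q∣ ((- 1ℚ) ^ n) p)
      (trans (cong (_* ∣ p ∣) (trans (∣^∣ (- 1ℚ) n) (1^ n))) (*-identityˡ ∣ p ∣))

    const-cauchy : ∀ p → Cauchy (λ _ → p)
    const-cauchy p ε 0<ε = 0 , λ _ _ → subst (_< ε) (cong ∣_∣ (sym (+-inverseʳ p))) 0<ε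

    uniform-cauchy : ∀ {x} →
      (∀ ε → 0ℚ < ε → ∃ λ y → Cauchy y × ∃ λ N → ∀ n → N ℕ.≤ n → ∣ x n - y n ∣ ≤ ε) → Cauchy x
    uniform-cauchy {x} approx ε 0<ε =
      let η = ½ * (½ * ε)
          y , cy , N , close = approx η (0<½* (0<½* 0<ε))
          M , cauchy = cy (½ * ε) (0<½* 0<ε)
      in N ℕ.⊔ M , λ {m} {n} ≤m ≤n → begin-strict
        ∣ x m - x n ∣                              ≤⟨ triangle (x m) (y m) (x n) ⟩
        ∣ x m - y m ∣ + ∣ y m - x n ∣              ≤⟨ +-mono-≤ (close m (ℕₚ.m⊔n≤o⇒m≤o N M ≤m)) (triangle (y m) (y n) (x n)) ⟩
        η + (∣ y m - y n ∣ + ∣ y n - x n ∣)        ≡⟨ cong (λ t → η + (∣ y m - y n ∣ + t)) (∣-∣-sym (y n) (x n)) ⟩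
        η + (∣ y m - y n ∣ + ∣ x n - y n ∣)        <⟨ +-monoʳ-< η (+-mono-<-≤ (cauchy (ℕₚ.m⊔n≤o⇒n≤o N M ≤m) (ℕₚ.m⊔n≤o⇒n≤o N M ≤n)) (close n (ℕₚ.m⊔n≤o⇒m≤o N M ≤n))) ⟩
        η + (½ * ε + η)                            ≡⟨ solve 1 (λ e → con ½ :* (con ½ :* e) :+ (con ½ :* e :+ con ½ :* (con ½ :* e)) := e) refl ε ⟩
        ε                                          ∎
      where open ≤-Reasoning

    eventually-bounded : ∀ {x} → Cauchy x → ∃ λ M → ∃ λ N → ∀ n → N ℕ.≤ n → ∣ x n ∣ ≤ ι M
    eventually-bounded {x} cx =
      let N , cauchy = cx 1ℚ (positive⁻¹ 1ℚ)
          M , bound = archimedean (1ℚ + ∣ x N ∣)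
      in M , N , λ n N≤n → ≤-trans (∣p∣≤∣p-r∣+∣r∣ (x n) (x N))
           (≤-trans (+-monoˡ-≤ ∣ x N ∣ (<⇒≤ (cauchy N≤n ℕₚ.≤-refl))) bound)

    +-cauchy : ∀ {x y} → Cauchy x → Cauchy y → Cauchy (λ n → x n + y n)
    +-cauchy {x} {y} cx cy ε 0<ε =
      let N , cauchyˣ = cx (½ * ε) (0<½* 0<ε)
          M , cauchyʸ = cy (½ * ε) (0<½* 0<ε)
      in N ℕ.⊔ M , λ {m} {n} ≤m ≤n → begin-strict
        ∣ x m + y m - (x n + y n) ∣    ≡⟨ cong ∣_∣ (solve 4 (λ a b c d → a :+ b :- (c :+ d) := (a :- c) :+ (b :- d)) refl (x m) (y m) (x n) (y n)) ⟩
        ∣ (x m - x n) + (y m - y n) ∣  ≤⟨ ∣p+q∣≤∣p∣+∣q∣ (x m - x n) (y m - y n) ⟩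
        ∣ x m - x n ∣ + ∣ y m - y n ∣  <⟨ +-mono-< (cauchyˣ (ℕₚ.m⊔n≤o⇒m≤o N M ≤m) (ℕₚ.m⊔n≤o⇒m≤o N M ≤n)) (cauchyʸ (ℕₚ.m⊔n≤o⇒n≤o N M ≤m) (ℕₚ.m⊔n≤o⇒n≤o N M ≤n)) ⟩
        ½ * ε + ½ * ε                  ≡⟨ half+half ε ⟩
        ε                              ∎
      where open ≤-Reasoning

    neg-cauchy : ∀ {x} → Cauchy x → Cauchy (λ n → - x n)
    neg-cauchy {x} cx ε 0<ε =
      let N , cauchy = cx ε 0<ε
      in N , λ {m} {n} ≤m ≤n → subst (_< ε)
           (trans (sym (∣-p∣≡∣p∣ (x m - x n))) (cong ∣_∣ (solve 2 (λ a b → :- (a :- b) := :- a :- :- b) refl (x m) (x n))))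
           (cauchy ≤m ≤n)

    *-cauchy : ∀ {x y} → Cauchy x → Cauchy y → Cauchy (λ n → x n * y n)
    *-cauchy {x} {y} cx cy ε 0<ε =
      let A , K , boundˣ = eventually-bounded {x} cx
          B , L , boundʸ = eventually-bounded {y} cy
          b = ι (suc (A ℕ.⊔ B))
          r , 0<r , r*b≡1 = recip b (0<ι (A ℕ.⊔ B))
          δ = ½ * ε * r
          0<δ = 0<* (0<½* 0<ε) 0<r
          N , cauchyˣ = cx δ 0<δ
          M , cauchyʸ = cy δ 0<δ
          P = (K ℕ.⊔ L) ℕ.⊔ (N ℕ.⊔ M)
          A≤ = ι-mono (ℕₚ.m≤n⇒m≤1+n (ℕₚ.m≤m⊔n A B))
          B≤ = ι-mono (ℕₚ.m≤n⇒m≤1+n (ℕₚ.m≤n⊔m A B))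
          split = λ {n} (≤n : P ℕ.≤ n) → ℕₚ.m⊔n≤o⇒m≤o (K ℕ.⊔ L) (N ℕ.⊔ M) ≤n , ℕₚ.m⊔n≤o⇒n≤o (K ℕ.⊔ L) (N ℕ.⊔ M) ≤n
      in P , λ {m} {n} ≤m ≤n →
        let KL≤m , NM≤m = split ≤m
            KL≤n , NM≤n = split ≤n
            xm≤b = ≤-trans (boundˣ m (ℕₚ.m⊔n≤o⇒m≤o K L KL≤m)) A≤
            yn≤b = ≤-trans (boundʸ n (ℕₚ.m⊔n≤o⇒n≤o K L KL≤n)) B≤
            xx = cauchyˣ (ℕₚ.m⊔n≤o⇒m≤o N M NM≤m) (ℕₚ.m⊔n≤o⇒m≤o N M NM≤n)
            yy = cauchyʸ (ℕₚ.m⊔n≤o⇒n≤o N M NM≤m) (ℕₚ.m⊔n≤o⇒n≤o N M NM≤n)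
        in begin-strict
        ∣ x m * y m - x n * y n ∣                          ≡⟨ cong ∣_∣ (solve 4 (λ a c d e → a :* c :- d :* e := a :* (c :- e) :+ e :* (a :- d)) refl (x m) (y m) (x n) (y n)) ⟩
        ∣ x m * (y m - y n) + y n * (x m - x n) ∣          ≤⟨ ∣p+q∣≤∣p∣+∣q∣ (x m * (y m - y n)) (y n * (x m - x n)) ⟩
        ∣ x m * (y m - y n) ∣ + ∣ y n * (x m - x n) ∣      ≡⟨ cong₂ _+_ (∣p*q∣≡∣p∣*∣q∣ (x m) (y m - y n)) (∣p*q∣≡∣p∣*∣q∣ (y n) (x m - x n)) ⟩
        ∣ x m ∣ * ∣ y m - y n ∣ + ∣ y n ∣ * ∣ x m - x n ∣  ≤⟨ +-mono-≤ (*-monoˡ (0≤∣p∣ (y m - y n)) xm≤b) (*-monoˡ (0≤∣p∣ (x m - x n)) yn≤b) ⟩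
        b * ∣ y m - y n ∣ + b * ∣ x m - x n ∣              <⟨ +-mono-< (*-monoʳ-<-pos b {{positive (0<ι (A ℕ.⊔ B))}} yy) (*-monoʳ-<-pos b {{positive (0<ι (A ℕ.⊔ B))}} xx) ⟩
        b * δ + b * δ                                      ≡⟨ solve 3 (λ b e r → b :* (con ½ :* e :* r) :+ b :* (con ½ :* e :* r) := e :* (r :* b)) refl b ε r ⟩
        ε * (r * b)                                        ≡⟨ cong (ε *_) r*b≡1 ⟩
        ε * 1ℚ                                             ≡⟨ *-identityʳ ε ⟩
        ε                                                  ∎
      where open ≤-Reasoning

    *-inv : ∀ p → p ≢ 0ℚ → p * inv p ≡ 1ℚ
    *-inv p p≢0 with p ≟ 0ℚ
    ... | yes p≡0 = ⊥-elim (p≢0 p≡0)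
    ... | no p≢0′ = *-inverseʳ p {{≢-nonZero p≢0′}}

    inv-cauchy : ∀ {x} δ N → 0ℚ < δ → (∀ n → N ℕ.≤ n → δ ≤ ∣ x n ∣) → Cauchy x → Cauchy (λ n → inv (x n))
    inv-cauchy {x} δ N 0<δ away cx ε 0<ε =
      let M , cauchy = cx (ε * (δ * δ)) (0<* 0<ε (0<* 0<δ 0<δ))
      in N ℕ.⊔ M , λ {m} {n} ≤m ≤n →
        let N≤m = ℕₚ.m⊔n≤o⇒m≤o N M ≤m
            N≤n = ℕₚ.m⊔n≤o⇒m≤o N M ≤n
            a = x m ; b = x n ; a′ = inv a ; b′ = inv b
        in *-cancelʳ-<-nonNeg (δ * δ) {{nonNegative (<⇒≤ (0<* 0<δ 0<δ))}} (begin-strict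
        ∣ a′ - b′ ∣ * (δ * δ)          ≤⟨ *-monoʳ (0≤∣p∣ (a′ - b′)) (*-mono (0≤∣p∣ a) (<⇒≤ 0<δ) (away m N≤m) (away n N≤n)) ⟩
        ∣ a′ - b′ ∣ * (∣ a ∣ * ∣ b ∣)  ≡⟨ cong (∣ a′ - b′ ∣ *_) (∣p*q∣≡∣p∣*∣q∣ a b) ⟨
        ∣ a′ - b′ ∣ * ∣ a * b ∣        ≡⟨ ∣p*q∣≡∣p∣*∣q∣ (a′ - b′) (a * b) ⟨
        ∣ (a′ - b′) * (a * b) ∣        ≡⟨ cong ∣_∣ (solve 4 (λ a b c d → (c :- d) :* (a :* b) := b :* (a :* c) :- a :* (b :* d)) refl a b a′ b′) ⟩
        ∣ b * (a * a′) - a * (b * b′) ∣ ≡⟨ cong₂ (λ s t → ∣ b * s - a * t ∣) (*-inv a (nonzero m N≤m)) (*-inv b (nonzero n N≤n)) ⟩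
        ∣ b * 1ℚ - a * 1ℚ ∣            ≡⟨ cong₂ (λ s t → ∣ s - t ∣) (*-identityʳ b) (*-identityʳ a) ⟩
        ∣ b - a ∣                      <⟨ cauchy (ℕₚ.m⊔n≤o⇒n≤o N M ≤n) (ℕₚ.m⊔n≤o⇒n≤o N M ≤m) ⟩
        ε * (δ * δ)                    ∎)
      where
        open ≤-Reasoning
        nonzero : ∀ n → N ℕ.≤ n → x n ≢ 0ℚ
        nonzero n N≤n xn≡0 = <⇒≱ 0<δ (subst (δ ≤_) (cong ∣_∣ xn≡0) (away n N≤n))
          where
            <⇒≱ : ∀ {a b} → a < b → b ≤ a → ⊥
            <⇒≱ a<b b≤a = <-irrefl refl (<-≤-trans a<b b≤a)

    0≤q : 0ℚ ≤ q
    0≤q = nonNegative⁻¹ q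

    q^j*j≤9 : ∀ j → q ^ j * (ι 9 + ι j) ≤ ι 9
    q^j*j≤9 zero    = ≤-reflexive refl
    q^j*j≤9 (suc j) = ≤-trans (≤-diff (q ^ j * ((+ 1 / 10) * ι j)) (0≤* (0≤^ j 0≤q) (0≤* (nonNegative⁻¹ (+ 1 / 10)) (0≤ι j)))
      (trans (cong (λ t → q * q ^ j * (ι 9 + t) + q ^ j * ((+ 1 / 10) * ι j)) (ι-suc j))
        (solve 2 (λ w i → con q :* w :* (con (ι 9) :+ (con 1ℚ :+ i)) :+ w :* (con (+ 1 / 10) :* i) := w :* (con (ι 9) :+ i)) refl (q ^ j) (ι j))))
      (q^j*j≤9 j)

    C*q^j-small : ∀ C ε → 0ℚ ≤ C → 0ℚ < ε → ∃ λ j → C * q ^ j ≤ ε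
    C*q^j-small C ε 0≤C 0<ε =
      let r , 0<r , r*ε≡1 = recip ε 0<ε
          j , large = archimedean (ι 9 * C * r)
          p = ι 9 + ι j
          0<p = +-mono-<-≤ (positive⁻¹ (ι 9)) (0≤ι j)
      in j , *-cancelʳ-≤-pos p {{positive 0<p}} (begin
        C * q ^ j * p          ≡⟨ *-assoc C (q ^ j) p ⟩
        C * (q ^ j * p)        ≤⟨ *-monoʳ 0≤C (q^j*j≤9 j) ⟩
        C * ι 9                ≡⟨ *-identityʳ (C * ι 9) ⟨
        C * ι 9 * 1ℚ           ≡⟨ cong (C * ι 9 *_) r*ε≡1 ⟨
        C * ι 9 * (r * ε)      ≡⟨ solve 3 (λ c r e → c :* con (ι 9) :* (r :* e) := e :* (con (ι 9) :* c :* r)) refl C r ε ⟩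
        ε * (ι 9 * C * r)      ≤⟨ *-monoʳ (<⇒≤ 0<ε) large ⟩
        ε * ι j                ≤⟨ *-monoʳ (<⇒≤ 0<ε) (≤-diff (ι 9) (0≤ι 9) (+-comm (ι j) (ι 9))) ⟩
        ε * p                  ∎)
      where open ≤-Reasoning

    geometric-tail : ∀ (z : ℕ → ℚ) C → 0ℚ ≤ C → (∀ j → ∣ z (suc j) - z j ∣ ≤ C * q ^ j) →
      ∀ i j → ∣ z (i ℕ.+ j) - z j ∣ ≤ ι 10 * C * q ^ j
    geometric-tail z C 0≤C step i j = ≤-trans (strong i)
      (≤-diff (ι 10 * C * q ^ (i ℕ.+ j)) (0≤* (0≤* (0≤ι 10) 0≤C) (0≤^ (i ℕ.+ j) 0≤q))
        (solve 3 (λ c a b → con (ι 10) :* c :* (a :- b) :+ con (ι 10) :* c :* b := con (ι 10) :* c :* a) refl C (q ^ j) (q ^ (i ℕ.+ j))))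
      where
        open ≤-Reasoning
        strong : ∀ i → ∣ z (i ℕ.+ j) - z j ∣ ≤ ι 10 * C * (q ^ j - q ^ (i ℕ.+ j))
        strong zero = ≤-reflexive (trans (cong ∣_∣ (+-inverseʳ (z j)))
          (sym (trans (cong (ι 10 * C *_) (+-inverseʳ (q ^ j))) (*-zeroʳ (ι 10 * C)))))
        strong (suc i) = begin
          ∣ z (suc i ℕ.+ j) - z j ∣                                   ≤⟨ triangle (z (suc i ℕ.+ j)) (z (i ℕ.+ j)) (z j) ⟩
          ∣ z (suc i ℕ.+ j) - z (i ℕ.+ j) ∣ + ∣ z (i ℕ.+ j) - z j ∣   ≤⟨ +-mono-≤ (step (i ℕ.+ j)) (strong i) ⟩
          C * q ^ (i ℕ.+ j) + ι 10 * C * (q ^ j - q ^ (i ℕ.+ j))       ≡⟨ solve 3 (λ c a b → c :* b :+ con (ι 10) :* c :* (a :- b) := con (ι 10) :* c :* (a :- con q :* b)) refl C (q ^ j) (q ^ (i ℕ.+ j)) ⟩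
          ι 10 * C * (q ^ j - q ^ (suc i ℕ.+ j))                      ∎

    geometric-cauchy : ∀ (z : ℕ → ℚ) C → 0ℚ ≤ C → (∀ j → ∣ z (suc j) - z j ∣ ≤ C * q ^ j) → Cauchy z
    geometric-cauchy z C 0≤C step = uniform-cauchy {z} λ ε 0<ε →
      let j , small = C*q^j-small (ι 10 * C) ε (0≤* (0≤ι 10) 0≤C) 0<ε
      in (λ _ → z j) , const-cauchy (z j) , j , λ n j≤n →
           ≤-trans (subst (λ m → ∣ z m - z j ∣ ≤ ι 10 * C * q ^ j) (ℕₚ.m∸n+n≡m j≤n) (geometric-tail z C 0≤C step (n ℕ.∸ j) j)) small

  -- The N-th partial sum of ∑ (-1)ᵏ z²ᵏ⁺σ / (2k+σ)!: the cosine for σ = 0, the sine for σ = 1.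
  taylor : ℕ → ℕ → ℚ → ℚ
  taylor σ N z = ∑± (λ k → z ^ (2 ℕ.* k ℕ.+ σ) * 1/! (2 ℕ.* k ℕ.+ σ)) N

  abstract
    exponent-suc : ∀ k σ → 2 ℕ.* suc k ℕ.+ σ ≡ suc (suc (2 ℕ.* k ℕ.+ σ))
    exponent-suc k σ = cong (ℕ._+ σ) (ℕₚ.*-suc 2 k)

    monomial-step : ∀ {z} c p → 0ℚ ≤ z → z ≤ c * ι (suc p) →
      z ^ suc p * 1/! suc p ≤ c * (z ^ p * 1/! p)
    monomial-step {z} c p 0≤z z≤ = begin
      z * z ^ p * f                   ≡⟨ *-assoc z (z ^ p) f ⟩
      z * (z ^ p * f)                 ≤⟨ *-monoˡ (0≤* (0≤^ p 0≤z) (0≤1/! (suc p))) z≤ ⟩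
      c * ι (suc p) * (z ^ p * f)     ≡⟨ solve 4 (λ c i w f → c :* i :* (w :* f) := c :* (w :* (f :* i))) refl c (ι (suc p)) (z ^ p) f ⟩
      c * (z ^ p * (f * ι (suc p)))   ≡⟨ cong (λ t → c * (z ^ p * t)) (1/!-suc p) ⟩
      c * (z ^ p * 1/! p)             ∎
      where
        open ≤-Reasoning
        f : ℚ
        f = 1/! suc p

    0≤monomial : ∀ {z} p → 0ℚ ≤ z → 0ℚ ≤ z ^ p * 1/! p
    0≤monomial p 0≤z = 0≤* (0≤^ p 0≤z) (0≤1/! p)

    monomial-step₂ : ∀ {z} c d p → 0ℚ ≤ z → 0ℚ ≤ c → 0ℚ ≤ d → z ≤ c * ι (suc p) → z ≤ d * ι (suc (suc p)) →
      z ^ suc (suc p) * 1/! suc (suc p) ≤ d * c * (z ^ p * 1/! p)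
    monomial-step₂ {z} c d p 0≤z 0≤c 0≤d z≤c z≤d = ≤-trans (monomial-step d (suc p) 0≤z z≤d)
      (≤-trans (*-monoʳ 0≤d (monomial-step c p 0≤z z≤c)) (≤-reflexive (sym (*-assoc d c (z ^ p * 1/! p)))))

    ∑±-cauchy : ∀ (s : ℕ → ℕ → ℚ) N → (∀ k → Cauchy (λ n → s n k)) → Cauchy (λ n → ∑± (s n) N)
    ∑±-cauchy s zero    cs = const-cauchy 0ℚ
    ∑±-cauchy s (suc N) cs = +-cauchy {λ n → ∑± (s n) N} {λ n → (- 1ℚ) ^ N * s n N} (∑±-cauchy s N cs)
      (*-cauchy {λ _ → (- 1ℚ) ^ N} {λ n → s n N} (const-cauchy ((- 1ℚ) ^ N)) (cs N))

    ^-cauchy : ∀ {x} p → Cauchy x → Cauchy (λ n → x n ^ p)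
    ^-cauchy zero    cx = const-cauchy 1ℚ
    ^-cauchy {x} (suc p) cx = *-cauchy {x} {λ n → x n ^ p} cx (^-cauchy {x} p cx)

    ∑±-step : ∀ s k → ∣ ∑± s (suc k) - ∑± s k ∣ ≡ ∣ s k ∣
    ∑±-step s k = trans (cong ∣_∣ (solve 2 (λ a b → a :+ b :- a := b) refl (∑± s k) ((- 1ℚ) ^ k * s k))) (∣±∣ k (s k))

    ∣monomial∣ : ∀ z p → ∣ z ^ p * 1/! p ∣ ≡ ∣ z ∣ ^ p * 1/! p
    ∣monomial∣ z p = trans (∣p*q∣≡∣p∣*∣q∣ (z ^ p) (1/! p)) (cong₂ _*_ (∣^∣ z p) (0≤p⇒∣p∣≡p (0≤1/! p)))

    taylor-tail : ∀ σ M → ∃ λ C → (0ℚ ≤ C) ×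
      (∀ z → ∣ z ∣ ≤ ι M → ∀ j → ∣ taylor σ (suc j ℕ.+ M) z - taylor σ (j ℕ.+ M) z ∣ ≤ C * q ^ j)
    taylor-tail σ M = v 0 , 0≤v 0 , λ z z≤M j →
        ≤-trans (≤-reflexive (trans (∑±-step (λ k → z ^ (2 ℕ.* k ℕ.+ σ) * 1/! (2 ℕ.* k ℕ.+ σ)) (j ℕ.+ M)) (∣monomial∣ z (e j))))
        (≤-trans (*-monoˡ (0≤1/! (e j)) (^-mono (e j) (0≤∣p∣ z) z≤M)) (decay j))
      where
        e : ℕ → ℕ
        e j = 2 ℕ.* (j ℕ.+ M) ℕ.+ σ
        v : ℕ → ℚ
        v j = ι M ^ e j * 1/! e j
        0≤v : ∀ j → 0ℚ ≤ v j
        0≤v j = 0≤monomial (e j) (0≤ι M)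
        ιM≤ : ∀ p → 2 ℕ.* M ℕ.≤ p → ι M ≤ ½ * ι p
        ιM≤ p 2M≤p = subst (_≤ ½ * ι p) (trans (cong (½ *_) (ι-double M)) (solve 1 (λ m → con ½ :* (m :+ m) := m) refl (ι M))) (*-monoʳ (nonNegative⁻¹ ½) (ι-mono 2M≤p))
          where
            ι-+ : ∀ m n → ι (m ℕ.+ n) ≡ ι m + ι n
            ι-+ zero n = sym (+-identityˡ (ι n))
            ι-+ (suc m) n = trans (ι-suc (m ℕ.+ n)) (trans (cong (λ t → 1ℚ + t) (ι-+ m n)) (trans (sym (+-assoc 1ℚ (ι m) (ι n))) (cong (_+ ι n) (sym (ι-suc m)))))
            ι-double : ∀ m → ι (2 ℕ.* m) ≡ ι m + ι m
            ι-double m = trans (cong (λ t → ι (m ℕ.+ t)) (ℕₚ.+-identityʳ m)) (ι-+ m m)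
        2M≤e : ∀ j → 2 ℕ.* M ℕ.≤ e j
        2M≤e j = ℕₚ.≤-trans (ℕₚ.*-monoʳ-≤ 2 (ℕₚ.m≤n+m M j)) (ℕₚ.m≤m+n _ σ)
        v-suc : ∀ j → v (suc j) ≤ q * v j
        v-suc j = subst (λ p → ι M ^ p * 1/! p ≤ q * v j) (sym (exponent-suc (j ℕ.+ M) σ))
          (≤-trans (monomial-step₂ ½ ½ (e j) (0≤ι M) (nonNegative⁻¹ ½) (nonNegative⁻¹ ½)
                     (ιM≤ _ (ℕₚ.m≤n⇒m≤1+n (2M≤e j))) (ιM≤ _ (ℕₚ.m≤n⇒m≤1+n (ℕₚ.m≤n⇒m≤1+n (2M≤e j)))))
            (*-monoˡ (0≤v j) (≤ᵇ⇒≤ {½ * ½} {q} _)))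
        decay : ∀ j → v j ≤ v 0 * q ^ j
        decay zero = ≤-reflexive (sym (*-identityʳ (v 0)))
        decay (suc j) = ≤-trans (v-suc j) (≤-trans (*-monoʳ 0≤q (decay j))
          (≤-reflexive (solve 3 (λ q v w → q :* (v :* w) := v :* (q :* w)) refl q (v 0) (q ^ j))))

    taylor-cauchy : ∀ σ {x} → Cauchy x → Cauchy (λ n → taylor σ n (x n))
    taylor-cauchy σ {x} cx = uniform-cauchy {λ n → taylor σ n (x n)} λ ε 0<ε →
      let M , N , bounded = eventually-bounded {x} cx
          C , 0≤C , step = taylor-tail σ M
          j , small = C*q^j-small (ι 10 * C) ε (0≤* (0≤ι 10) 0≤C) 0<ε
      in (λ n → taylor σ (j ℕ.+ M) (x n))
       , ∑±-cauchy (λ n k → x n ^ (2 ℕ.* k ℕ.+ σ) * 1/! (2 ℕ.* k ℕ.+ σ)) (j ℕ.+ M)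
           (λ k → *-cauchy {λ n → x n ^ (2 ℕ.* k ℕ.+ σ)} {λ _ → 1/! (2 ℕ.* k ℕ.+ σ)} (^-cauchy {x} (2 ℕ.* k ℕ.+ σ) cx) (const-cauchy (1/! (2 ℕ.* k ℕ.+ σ))))
       , N ℕ.⊔ (j ℕ.+ M)
       , λ n ≤n → ≤-trans
           (subst (λ m → ∣ taylor σ m (x n) - taylor σ (j ℕ.+ M) (x n) ∣ ≤ ι 10 * C * q ^ j)
             (trans (ℕₚ.+-assoc (n ℕ.∸ (j ℕ.+ M)) j M) (ℕₚ.m∸n+n≡m (ℕₚ.m⊔n≤o⇒n≤o N (j ℕ.+ M) ≤n)))
             (geometric-tail (λ i → taylor σ (i ℕ.+ M) (x n)) C 0≤C (step (x n) (bounded n (ℕₚ.m⊔n≤o⇒m≤o N (j ℕ.+ M) ≤n))) (n ℕ.∸ (j ℕ.+ M)) j))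
           small

    ∑±-peel : ∀ s m → ∑± s (suc m) ≡ s 0 - ∑± (λ k → s (suc k)) m
    ∑±-peel s zero = solve 1 (λ a → con 0ℚ :+ con 1ℚ :* a := a :- con 0ℚ) refl (s 0)
    ∑±-peel s (suc m) = trans (cong (λ t → t + (- 1ℚ) * (- 1ℚ) ^ m * s (suc m)) (∑±-peel s m))
      (solve 4 (λ a b c d → a :- b :+ (:- con 1ℚ) :* c :* d := a :- (b :+ c :* d)) refl
        (s 0) (∑± (λ k → s (suc k)) m) ((- 1ℚ) ^ m) (s (suc m)))

    ∑±-sub : ∀ s t m → ∑± (λ k → s k - t k) m ≡ ∑± s m - ∑± t m
    ∑±-sub s t zero = refl
    ∑±-sub s t (suc m) = trans (cong (λ a → a + (- 1ℚ) ^ m * (s m - t m)) (∑±-sub s t m))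
      (solve 5 (λ a b c d e → a :- b :+ c :* (d :- e) := a :+ c :* d :- (b :+ c :* e)) refl
        (∑± s m) (∑± t m) ((- 1ℚ) ^ m) (s m) (t m))

    module _ (r : ℚ) (r≤1 : r ≤ 1ℚ) where

      ∑±-bounds : ∀ s → (∀ k → 0ℚ ≤ s k) → (∀ k → s (suc k) ≤ r * s k) →
        ∀ m → (0ℚ ≤ ∑± s m) × (∑± s m ≤ s 0)
      ∑±-bounds s 0≤s s-suc zero = ≤-refl , 0≤s 0
      ∑±-bounds s 0≤s s-suc (suc m) =
        let lo , hi = ∑±-bounds (λ k → s (suc k)) (λ k → 0≤s (suc k)) (λ k → s-suc (suc k)) m
            A = ∑± (λ k → s (suc k)) m
        in subst (0ℚ ≤_) (sym (∑±-peel s m))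
             (0≤b-a (≤-trans hi (≤-trans (s-suc 0) (≤-trans (*-monoˡ (0≤s 0) r≤1) (≤-reflexive (*-identityˡ (s 0)))))))
         , subst (_≤ s 0) (sym (∑±-peel s m)) (≤-diff A lo (solve 2 (λ a b → a :- b :+ b := a) refl (s 0) A))

      ∑±-lower : ∀ s → (∀ k → 0ℚ ≤ s k) → (∀ k → s (suc k) ≤ r * s k) →
        ∀ m → (1ℚ - r) * s 0 ≤ ∑± s (suc m)
      ∑±-lower s 0≤s s-suc m =
        let lo , hi = ∑±-bounds (λ k → s (suc k)) (λ k → 0≤s (suc k)) (λ k → s-suc (suc k)) m
            A = ∑± (λ k → s (suc k)) m
        in subst ((1ℚ - r) * s 0 ≤_) (sym (∑±-peel s m))
             (≤-diff (r * s 0 - A) (0≤b-a (≤-trans hi (s-suc 0)))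
               (solve 3 (λ a b r → (con 1ℚ :- r) :* a :+ (r :* a :- b) := a :- b) refl (s 0) A r))

  evenPower cosTerm : ℚ → ℕ → ℚ
  evenPower z k = z ^ (2 ℕ.* k ℕ.+ 0)
  cosTerm z k = evenPower z k * 1/! (2 ℕ.* k ℕ.+ 0)

  b : ℚ
  b = + 9 / 5

  abstract
    lit≤ : ∀ {x y : ℚ} {_ : ℚ.NonNegative (y - x)} → x ≤ y
    lit≤ {x} {y} {nn} = ≤-diff (y - x) (nonNegative⁻¹ (y - x) {{nn}}) (solve 2 (λ x y → x :+ (y :- x) := y) refl x y)

    evenPower-suc : ∀ z k → evenPower z (suc k) ≡ z * z * evenPower z k
    evenPower-suc z k = trans (cong (z ^_) (exponent-suc k 0)) (sym (*-assoc z z (evenPower z k)))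

    3≤ : ∀ k → ι 3 ≤ ι (suc (2 ℕ.* suc k ℕ.+ 0))
    3≤ k = ι-mono {3} {suc (2 ℕ.* suc k ℕ.+ 0)} (s≤s (ℕₚ.≤-trans (ℕₚ.*-monoʳ-≤ 2 {1} {suc k} (s≤s z≤n)) (ℕₚ.m≤m+n (2 ℕ.* suc k) 0)))

    4≤ : ∀ k → ι 4 ≤ ι (suc (suc (2 ℕ.* suc k ℕ.+ 0)))
    4≤ k = ι-mono {4} {suc (suc (2 ℕ.* suc k ℕ.+ 0))} (s≤s (s≤s (ℕₚ.≤-trans (ℕₚ.*-monoʳ-≤ 2 {1} {suc k} (s≤s z≤n)) (ℕₚ.m≤m+n (2 ℕ.* suc k) 0))))

    0≤cosTerm : ∀ {z} → 0ℚ ≤ z → ∀ k → 0ℚ ≤ cosTerm z k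
    0≤cosTerm 0≤z k = 0≤monomial (2 ℕ.* k ℕ.+ 0) 0≤z

    cosTerm-suc : ∀ {z} → 0ℚ ≤ z → z ≤ b → ∀ k → cosTerm z (suc (suc k)) ≤ (+ 1 / 3) * cosTerm z (suc k)
    cosTerm-suc {z} 0≤z z≤b k = subst (λ p → z ^ p * 1/! p ≤ (+ 1 / 3) * cosTerm z (suc k)) (sym (exponent-suc (suc k) 0))
      (monomial-step₂ (+ 2 / 3) ½ (2 ℕ.* suc k ℕ.+ 0) 0≤z (nonNegative⁻¹ (+ 2 / 3)) (nonNegative⁻¹ ½)
        (≤-trans z≤b (≤-trans lit≤ (*-monoʳ {+ 2 / 3} {ι 3} (nonNegative⁻¹ (+ 2 / 3)) (3≤ k))))
        (≤-trans z≤b (≤-trans lit≤ (*-monoʳ {½} {ι 4} (nonNegative⁻¹ ½) (4≤ k)))))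

    cosTerm-1 : ∀ z → cosTerm z 1 ≡ ½ * (z * z)
    cosTerm-1 z = solve 1 (λ z → z :* (z :* con 1ℚ) :* con ½ := con ½ :* (z :* z)) refl z

    taylor-cos : ∀ m z → taylor 0 (suc m) z ≡ 1ℚ - ∑± (λ k → cosTerm z (suc k)) m
    taylor-cos m z = ∑±-peel (cosTerm z) m

    cos-bounds : ∀ {z} → 0ℚ ≤ z → z ≤ b → ∀ m →
      (1ℚ - ½ * (z * z) ≤ taylor 0 (suc (suc m)) z) × (taylor 0 (suc (suc m)) z ≤ 1ℚ - (+ 1 / 3) * (z * z))
    cos-bounds {z} 0≤z z≤b m =
      let s = λ k → cosTerm z (suc k)
          0≤s = λ k → 0≤cosTerm 0≤z (suc k)
          s-suc = cosTerm-suc 0≤z z≤b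
          lo = ∑±-lower (+ 1 / 3) lit≤ s 0≤s s-suc m
          hi = proj₂ (∑±-bounds (+ 1 / 3) lit≤ s 0≤s s-suc (suc m))
          lo′ = subst (_≤ ∑± s (suc m)) (trans (cong ((1ℚ - (+ 1 / 3)) *_) (cosTerm-1 z))
                  (solve 1 (λ w → (con 1ℚ :- con (+ 1 / 3)) :* (con ½ :* w) := con (+ 1 / 3) :* w) refl (z * z))) lo
          hi′ = subst (∑± s (suc m) ≤_) (cosTerm-1 z) hi
      in subst (1ℚ - ½ * (z * z) ≤_) (sym (taylor-cos (suc m) z)) (+-monoʳ-≤ 1ℚ (neg-antimono-≤ hi′))
       , subst (_≤ 1ℚ - (+ 1 / 3) * (z * z)) (sym (taylor-cos (suc m) z)) (+-monoʳ-≤ 1ℚ (neg-antimono-≤ lo′))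

    evenPower-mono : ∀ {y z} → 0ℚ ≤ y → y ≤ z → ∀ k → 0ℚ ≤ evenPower z k - evenPower y k
    evenPower-mono 0≤y y≤z k = 0≤b-a (^-mono (2 ℕ.* k ℕ.+ 0) 0≤y y≤z)

    evenPower-diff : ∀ y z k → evenPower z (suc k) - evenPower y (suc k) ≡
      (z * z - y * y) * evenPower y k + z * z * (evenPower z k - evenPower y k)
    evenPower-diff y z k = trans (cong₂ _-_ (evenPower-suc z k) (evenPower-suc y k))
      (solve 4 (λ z y p r → z :* z :* p :- y :* y :* r := (z :* z :- y :* y) :* r :+ z :* z :* (p :- r)) refl z y (evenPower z k) (evenPower y k))

    evenPower-diff-suc : ∀ {y z} → 0ℚ ≤ y → y ≤ z → z ≤ b → ∀ k →
      evenPower z (suc (suc k)) - evenPower y (suc (suc k)) ≤ ι 8 * (evenPower z (suc k) - evenPower y (suc k))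
    evenPower-diff-suc {y} {z} 0≤y y≤z z≤b k = begin
      E (suc (suc k))                                        ≡⟨ evenPower-diff y z (suc k) ⟩
      (z * z - y * y) * evenPower y (suc k) + z * z * D      ≡⟨ cong (λ t → (z * z - y * y) * t + z * z * D) (evenPower-suc y k) ⟩
      (z * z - y * y) * (y * y * w) + z * z * D              ≡⟨ solve 4 (λ z y w d → (z :* z :- y :* y) :* (y :* y :* w) :+ z :* z :* d := y :* y :* ((z :* z :- y :* y) :* w) :+ z :* z :* d) refl z y w D ⟩
      y * y * ((z * z - y * y) * w) + z * z * D              ≤⟨ +-monoˡ-≤ (z * z * D) (*-monoʳ (0≤* 0≤y 0≤y) low) ⟩
      y * y * D + z * z * D                                  ≤⟨ +-mono-≤ (*-monoˡ 0≤D (sq (≤-trans y≤z z≤b) 0≤y)) (*-monoˡ 0≤D (sq z≤b 0≤z)) ⟩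
      ι 4 * D + ι 4 * D                                      ≡⟨ solve 1 (λ d → con (ι 4) :* d :+ con (ι 4) :* d := con (ι 8) :* d) refl D ⟩
      ι 8 * D ∎
      where
        open ≤-Reasoning
        0≤z : 0ℚ ≤ z
        0≤z = ≤-trans 0≤y y≤z
        E : ℕ → ℚ
        E k = evenPower z k - evenPower y k
        D w : ℚ
        D = E (suc k)
        w = evenPower y k
        0≤D : 0ℚ ≤ D
        0≤D = evenPower-mono 0≤y y≤z (suc k)
        low : (z * z - y * y) * w ≤ D
        low = ≤-diff (z * z * E k) (0≤* (0≤* 0≤z 0≤z) (evenPower-mono 0≤y y≤z k)) (sym (evenPower-diff y z k))
        sq : ∀ {x} → x ≤ b → 0ℚ ≤ x → x * x ≤ ι 4
        sq x≤b 0≤x = ≤-trans (*-mono (nonNegative⁻¹ b) 0≤x x≤b x≤b) lit≤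

    1/!-suc-suc : ∀ k → 1/! (2 ℕ.* suc (suc k) ℕ.+ 0) ≤ (+ 1 / 12) * 1/! (2 ℕ.* suc k ℕ.+ 0)
    1/!-suc-suc k = subst (λ p → 1/! p ≤ (+ 1 / 12) * 1/! e) (sym (exponent-suc (suc k) 0))
      (subst₂ (λ s t → s ≤ (+ 1 / 12) * t) (one (suc (suc e))) (one e)
        (monomial-step₂ (+ 1 / 3) (+ 1 / 4) e (nonNegative⁻¹ 1ℚ) (nonNegative⁻¹ (+ 1 / 3)) (nonNegative⁻¹ (+ 1 / 4))
          (≤-trans lit≤ (*-monoʳ {+ 1 / 3} {ι 3} (nonNegative⁻¹ (+ 1 / 3)) (3≤ k)))
          (≤-trans lit≤ (*-monoʳ {+ 1 / 4} {ι 4} (nonNegative⁻¹ (+ 1 / 4)) (4≤ k)))))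
      where
        e : ℕ
        e = 2 ℕ.* suc k ℕ.+ 0
        one : ∀ p → 1ℚ ^ p * 1/! p ≡ 1/! p
        one p = trans (cong (_* 1/! p) (1^ p)) (*-identityˡ (1/! p))

    cos-contracts′ : ∀ {y z} → 1ℚ ≤ y → y ≤ z → z ≤ b → ∀ m →
      ∣ (z - y) + (taylor 0 (suc (suc m)) z - taylor 0 (suc (suc m)) y) ∣ ≤ (+ 4 / 5) * (z - y)
    cos-contracts′ {y} {z} 1≤y y≤z z≤b m = subst (λ t → ∣ t ∣ ≤ (+ 4 / 5) * (z - y)) (sym whole)
      (∣p∣≤ upper lower)
      where
        open ≤-Reasoning
        0≤y : 0ℚ ≤ y
        0≤y = ≤-trans lit≤ 1≤y
        s : ℕ → ℚ
        s k = cosTerm z (suc k) - cosTerm y (suc k)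
        A : ℚ
        A = ∑± s (suc m)
        s≡ : ∀ k → s k ≡ (evenPower z (suc k) - evenPower y (suc k)) * 1/! (2 ℕ.* suc k ℕ.+ 0)
        s≡ k = solve 3 (λ p r f → p :* f :- r :* f := (p :- r) :* f) refl (evenPower z (suc k)) (evenPower y (suc k)) (1/! (2 ℕ.* suc k ℕ.+ 0))
        0≤s : ∀ k → 0ℚ ≤ s k
        0≤s k = subst (0ℚ ≤_) (sym (s≡ k)) (0≤* (evenPower-mono 0≤y y≤z (suc k)) (0≤1/! (2 ℕ.* suc k ℕ.+ 0)))
        s-suc : ∀ k → s (suc k) ≤ (+ 2 / 3) * s k
        s-suc k = begin
          s (suc k)                                     ≡⟨ s≡ (suc k) ⟩
          d′ * 1/! (2 ℕ.* suc (suc k) ℕ.+ 0)            ≤⟨ *-mono {d′} {ι 8 * d} (0≤* (0≤ι 8) (evenPower-mono 0≤y y≤z (suc k))) (0≤1/! (2 ℕ.* suc (suc k) ℕ.+ 0))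
                                                             (evenPower-diff-suc 0≤y y≤z z≤b k) (1/!-suc-suc k) ⟩
          ι 8 * d * ((+ 1 / 12) * f)                    ≡⟨ solve 2 (λ d f → con (ι 8) :* d :* (con (+ 1 / 12) :* f) := con (+ 2 / 3) :* (d :* f)) refl d f ⟩
          (+ 2 / 3) * (d * f)                           ≡⟨ cong ((+ 2 / 3) *_) (s≡ k) ⟨
          (+ 2 / 3) * s k                               ∎
          where
            d d′ f : ℚ
            d  = evenPower z (suc k) - evenPower y (suc k)
            d′ = evenPower z (suc (suc k)) - evenPower y (suc (suc k))
            f  = 1/! (2 ℕ.* suc k ℕ.+ 0)
        s0 : s 0 ≡ ½ * ((z - y) * (z + y))
        s0 = trans (cong₂ _-_ (cosTerm-1 z) (cosTerm-1 y)) (solve 2 (λ z y → con ½ :* (z :* z) :- con ½ :* (y :* y) := con ½ :* ((z :- y) :* (z :+ y))) refl z y)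
        whole : (z - y) + (taylor 0 (suc (suc m)) z - taylor 0 (suc (suc m)) y) ≡ (z - y) - A
        whole = trans (cong₂ (λ t u → (z - y) + (t - u)) (taylor-cos (suc m) z) (taylor-cos (suc m) y))
          (trans (solve 4 (λ z y s t → (z :- y) :+ ((con 1ℚ :- s) :- (con 1ℚ :- t)) := (z :- y) :- (s :- t)) refl z y
                   (∑± (λ k → cosTerm z (suc k)) (suc m)) (∑± (λ k → cosTerm y (suc k)) (suc m)))
            (cong (λ t → (z - y) - t) (sym (∑±-sub (λ k → cosTerm z (suc k)) (λ k → cosTerm y (suc k)) (suc m)))))
        0≤z-y : 0ℚ ≤ z - y
        0≤z-y = 0≤b-a y≤z
        A≤ : A ≤ b * (z - y)
        A≤ = begin
          A                              ≤⟨ proj₂ (∑±-bounds (+ 2 / 3) lit≤ s 0≤s s-suc (suc m)) ⟩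
          s 0                            ≡⟨ s0 ⟩
          ½ * ((z - y) * (z + y))        ≤⟨ *-monoʳ (nonNegative⁻¹ ½) (*-monoʳ 0≤z-y (+-mono-≤ z≤b (≤-trans y≤z z≤b))) ⟩
          ½ * ((z - y) * (b + b))        ≡⟨ solve 1 (λ d → con ½ :* (d :* (con b :+ con b)) := con b :* d) refl (z - y) ⟩
          b * (z - y)                    ∎
        ≤A : (+ 1 / 3) * (z - y) ≤ A
        ≤A = begin
          (+ 1 / 3) * (z - y)                              ≡⟨ solve 1 (λ d → con (+ 1 / 3) :* d := (con 1ℚ :- con (+ 2 / 3)) :* (con ½ :* (d :* (con 1ℚ :+ con 1ℚ)))) refl (z - y) ⟩
          (1ℚ - (+ 2 / 3)) * (½ * ((z - y) * (1ℚ + 1ℚ)))   ≤⟨ *-monoʳ {1ℚ - (+ 2 / 3)} lit≤ (*-monoʳ (nonNegative⁻¹ ½) (*-monoʳ 0≤z-y (+-mono-≤ (≤-trans 1≤y y≤z) 1≤y))) ⟩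
          (1ℚ - (+ 2 / 3)) * (½ * ((z - y) * (z + y)))     ≡⟨ cong ((1ℚ - (+ 2 / 3)) *_) s0 ⟨
          (1ℚ - (+ 2 / 3)) * s 0                           ≤⟨ ∑±-lower (+ 2 / 3) lit≤ s 0≤s s-suc m ⟩
          A                                                ∎
        upper : (z - y) - A ≤ (+ 4 / 5) * (z - y)
        upper = begin
          (z - y) - A                    ≤⟨ +-monoʳ-≤ (z - y) (neg-antimono-≤ ≤A) ⟩
          (z - y) - (+ 1 / 3) * (z - y)  ≡⟨ solve 1 (λ d → d :- con (+ 1 / 3) :* d := con (+ 2 / 3) :* d) refl (z - y) ⟩
          (+ 2 / 3) * (z - y)            ≤⟨ *-monoˡ {z - y} {+ 2 / 3} {+ 4 / 5} 0≤z-y lit≤ ⟩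
          (+ 4 / 5) * (z - y)            ∎
        lower : - ((z - y) - A) ≤ (+ 4 / 5) * (z - y)
        lower = begin
          - ((z - y) - A)                ≡⟨ solve 2 (λ d a → :- (d :- a) := a :- d) refl (z - y) A ⟩
          A - (z - y)                    ≤⟨ +-monoˡ-≤ (- (z - y)) A≤ ⟩
          b * (z - y) - (z - y)          ≡⟨ solve 1 (λ d → con b :* d :- d := con (+ 4 / 5) :* d) refl (z - y) ⟩
          (+ 4 / 5) * (z - y)            ∎

    cos-contracts : ∀ {y z} → 1ℚ ≤ y → y ≤ b → 1ℚ ≤ z → z ≤ b → ∀ m →
      ∣ (z - y) + (taylor 0 (suc (suc m)) z - taylor 0 (suc (suc m)) y) ∣ ≤ (+ 4 / 5) * ∣ z - y ∣
    cos-contracts {y} {z} 1≤y y≤b 1≤z z≤b m with ≤-total y z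
    ... | inj₁ y≤z = ≤-trans (cos-contracts′ 1≤y y≤z z≤b m) (*-monoʳ (nonNegative⁻¹ (+ 4 / 5)) (p≤∣p∣ (z - y)))
    ... | inj₂ z≤y = subst₂ _≤_
      (trans (sym (∣-p∣≡∣p∣ ((y - z) + (t y - t z)))) (cong ∣_∣ (solve 4 (λ y z a c → :- ((y :- z) :+ (a :- c)) := (z :- y) :+ (c :- a)) refl y z (t y) (t z))))
      (cong ((+ 4 / 5) *_) (∣-∣-sym y z))
      (≤-trans (cos-contracts′ 1≤z z≤y y≤b m) (*-monoʳ (nonNegative⁻¹ (+ 4 / 5)) (p≤∣p∣ (y - z))))
      where
        t : ℚ → ℚ
        t = taylor 0 (suc (suc m))

  π/2-approx : ℕ → ℚ
  π/2-approx zero    = 1ℚ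
  π/2-approx (suc n) = π/2-approx n + taylor 0 (2 ℕ.+ n) (π/2-approx n)

  abstract
    π/2-range : ∀ n → (1ℚ ≤ π/2-approx n) × (π/2-approx n ≤ b)
    π/2-range zero = ≤-refl , lit≤
    π/2-range (suc n) =
      let z = π/2-approx n
          1≤z , z≤b = π/2-range n
          0≤z = ≤-trans lit≤ 1≤z
          lo , hi = cos-bounds 0≤z z≤b n
          2-z = 0≤b-a (≤-trans z≤b (lit≤ {b} {ι 2}))
          w = z - (+ 3 / 2)
      in ≤-trans (≤-diff (½ * (z * (ι 2 - z))) (0≤* (nonNegative⁻¹ ½) (0≤* 0≤z 2-z))
           (solve 1 (λ z → con 1ℚ :+ con ½ :* (z :* (con (ι 2) :- z)) := z :+ (con 1ℚ :- con ½ :* (z :* z))) refl z))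
           (+-monoʳ-≤ z lo)
       , ≤-trans (+-monoʳ-≤ z hi) (≤-trans (≤-diff ((+ 1 / 3) * (w * w)) (0≤* (nonNegative⁻¹ (+ 1 / 3)) (square w))
           (solve 1 (λ z → z :+ (con 1ℚ :- con (+ 1 / 3) :* (z :* z)) :+ con (+ 1 / 3) :* ((z :- con (+ 3 / 2)) :* (z :- con (+ 3 / 2))) := con (+ 7 / 4)) refl z)) lit≤)
      where
        square : ∀ w → 0ℚ ≤ w * w
        square w with ≤-total 0ℚ w
        ... | inj₁ 0≤w = 0≤* 0≤w 0≤w
        ... | inj₂ w≤0 = subst (0ℚ ≤_) (solve 1 (λ w → :- w :* :- w := w :* w) refl w) (0≤* (neg-antimono-≤ w≤0) (neg-antimono-≤ w≤0))

    cosTerm-decay : ∀ {z} → 0ℚ ≤ z → z ≤ b → ∀ n → cosTerm z (suc (suc n)) ≤ q ^ n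
    cosTerm-decay {z} 0≤z z≤b zero = ≤-trans (cosTerm-suc 0≤z z≤b 0) (≤-trans
      (*-monoʳ (nonNegative⁻¹ (+ 1 / 3)) (≤-trans (≤-reflexive (cosTerm-1 z)) (*-monoʳ (nonNegative⁻¹ ½) (*-mono (nonNegative⁻¹ b) 0≤z z≤b z≤b)))) lit≤)
    cosTerm-decay {z} 0≤z z≤b (suc n) = ≤-trans (cosTerm-suc 0≤z z≤b (suc n))
      (*-mono {+ 1 / 3} {q} {cosTerm z (suc (suc n))} {q ^ n} 0≤q (0≤cosTerm 0≤z (suc (suc n))) lit≤ (cosTerm-decay 0≤z z≤b n))

    π/2-step : ∀ n → ∣ π/2-approx (suc n) - π/2-approx n ∣ ≤ ι 10 * q ^ n
    π/2-step zero = ≤ᵇ⇒≤ _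
    π/2-step (suc n) =
      let w = π/2-approx n
          u = π/2-approx (suc n)
          t = taylor 0 (2 ℕ.+ n)
          t⁺ = taylor 0 (3 ℕ.+ n)
          1≤w , w≤b = π/2-range n
          1≤u , u≤b = π/2-range (suc n)
          0≤u = ≤-trans lit≤ 1≤u
      in begin
        ∣ u + t⁺ u - (w + t w) ∣                              ≡⟨ cong ∣_∣ (solve 5 (λ u w a c d → u :+ a :- (w :+ d) := ((u :- w) :+ (c :- d)) :+ (a :- c)) refl u w (t⁺ u) (t u) (t w)) ⟩
        ∣ ((u - w) + (t u - t w)) + (t⁺ u - t u) ∣            ≤⟨ ∣p+q∣≤∣p∣+∣q∣ ((u - w) + (t u - t w)) (t⁺ u - t u) ⟩
        ∣ (u - w) + (t u - t w) ∣ + ∣ t⁺ u - t u ∣            ≡⟨ cong (λ r → ∣ (u - w) + (t u - t w) ∣ + r) (trans (∑±-step (cosTerm u) (2 ℕ.+ n)) (0≤p⇒∣p∣≡p (0≤cosTerm 0≤u (2 ℕ.+ n)))) ⟩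
        ∣ (u - w) + (t u - t w) ∣ + cosTerm u (2 ℕ.+ n)       ≤⟨ +-mono-≤ (cos-contracts 1≤w w≤b 1≤u u≤b n) (cosTerm-decay 0≤u u≤b n) ⟩
        (+ 4 / 5) * ∣ u - w ∣ + q ^ n                         ≤⟨ +-monoˡ-≤ (q ^ n) (*-monoʳ (nonNegative⁻¹ (+ 4 / 5)) (π/2-step n)) ⟩
        (+ 4 / 5) * (ι 10 * q ^ n) + q ^ n                    ≡⟨ solve 1 (λ w → con (+ 4 / 5) :* (con (ι 10) :* w) :+ w := con (ι 10) :* (con q :* w)) refl (q ^ n) ⟩
        ι 10 * (q * q ^ n)                                    ∎
      where open ≤-Reasoning

    π/2-cauchy : Cauchy π/2-approx
    π/2-cauchy = geometric-cauchy π/2-approx (ι 10) (0≤ι 10) π/2-step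

    q^-antitone : ∀ i j → q ^ (i ℕ.+ j) ≤ q ^ j
    q^-antitone zero    j = ≤-refl
    q^-antitone (suc i) j = ≤-trans (*-monoˡ (0≤^ (i ℕ.+ j) 0≤q) (lit≤ {q} {1ℚ}))
      (≤-trans (≤-reflexive (*-identityˡ (q ^ (i ℕ.+ j)))) (q^-antitone i j))

    cos-π/2-null : ∀ ε → 0ℚ < ε → ∃ λ N → ∀ n → N ℕ.≤ n → ∣ taylor 0 n (π/2-approx n) ∣ < ε
    cos-π/2-null ε 0<ε =
      let j , small = C*q^j-small (ι 12) (½ * ε) (0≤ι 12) (0<½* 0<ε)
          ½ε<ε = subst₂ _<_ (+-identityʳ (½ * ε)) (half+half ε) (+-monoʳ-< (½ * ε) (0<½* 0<ε))
      in 2 ℕ.+ j , λ n 2+j≤n → subst (λ n → ∣ taylor 0 n (π/2-approx n) ∣ < ε)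
           (trans (cong (2 ℕ.+_) (ℕₚ.m∸n+n≡m {n ℕ.∸ 2} {j} (ℕₚ.∸-monoˡ-≤ 2 2+j≤n))) (ℕₚ.m+[n∸m]≡n {2} (ℕₚ.≤-trans (ℕₚ.m≤m+n 2 j) 2+j≤n)))
           (≤-<-trans (bound (n ℕ.∸ 2 ℕ.∸ j ℕ.+ j))
             (≤-<-trans (≤-trans (*-monoʳ (0≤ι 12) (q^-antitone (n ℕ.∸ 2 ℕ.∸ j) j)) small) ½ε<ε))
      where
        open ≤-Reasoning
        bound : ∀ k → ∣ taylor 0 (2 ℕ.+ k) (π/2-approx (2 ℕ.+ k)) ∣ ≤ ι 12 * q ^ k
        bound k =
          let h = π/2-approx (2 ℕ.+ k)
              t = λ i → taylor 0 (i ℕ.+ k) h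
              1≤h , h≤b = π/2-range (2 ℕ.+ k)
              0≤h = ≤-trans lit≤ 1≤h
              term = λ i → trans (∣-∣-sym (t i) (t (suc i))) (trans (∑±-step (cosTerm h) (i ℕ.+ k)) (0≤p⇒∣p∣≡p (0≤cosTerm 0≤h (i ℕ.+ k))))
          in begin
          ∣ t 2 ∣                                            ≤⟨ ∣p∣≤∣p-r∣+∣r∣ (t 2) (t 3) ⟩
          ∣ t 2 - t 3 ∣ + ∣ t 3 ∣                            ≤⟨ +-monoʳ-≤ ∣ t 2 - t 3 ∣ (∣p∣≤∣p-r∣+∣r∣ (t 3) (t 4)) ⟩
          ∣ t 2 - t 3 ∣ + (∣ t 3 - t 4 ∣ + ∣ t 4 ∣)          ≡⟨ cong₂ (λ r s → r + (s + ∣ t 4 ∣)) (term 2) (term 3) ⟩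
          cosTerm h (2 ℕ.+ k) + (cosTerm h (3 ℕ.+ k) + ∣ t 4 ∣) ≤⟨ +-mono-≤ (cosTerm-decay 0≤h h≤b k) (+-mono-≤
                                                                     (≤-trans (cosTerm-decay 0≤h h≤b (suc k)) (q^-antitone 1 k))
                                                                     (≤-trans (≤-reflexive (cong ∣_∣ (solve 2 (λ a b → a := b :+ a :- b) refl (t 4) h)))
                                                                       (≤-trans (π/2-step (2 ℕ.+ k)) (*-monoʳ (0≤ι 10) (q^-antitone 2 k))))) ⟩
          q ^ k + (q ^ k + ι 10 * q ^ k)                      ≡⟨ solve 1 (λ w → w :+ (w :+ con (ι 10) :* w) := con (ι 12) :* w) refl (q ^ k) ⟩
          ι 12 * q ^ k                                       ∎

open import Data.Nat.Base using (_≤_; _<_; _∸_)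
open Rational using (Cauchy; ι; inv; taylor)

-- `Cauchy` is a Σ-type, so every real carries its modulus of convergence and the operations
-- below can act termwise. Equality of reals is the setoid relation `_≃_`.
record ℝ : Set where
  constructor real
  field
    seq    : ℕ → ℚ
    cauchy : Cauchy seq

open ℝ public

infix  4 _≃_ _#0
infixl 6 _+_ _-_
infixl 7 _*_
infix  8 -_
infix  9 _⁻¹[_] _²

_≃_ : ℝ → ℝ → Set
x ≃ y = ∀ ε → 0ℚ ℚ.< ε → ∃ λ N → ∀ n → N ≤ n → ℚ.∣ seq x n ℚ.- seq y n ∣ ℚ.< ε

_#0 : ℝ → Set
x #0 = ∃ λ δ → 0ℚ ℚ.< δ × ∃ λ N → ∀ n → N ≤ n → δ ℚ.≤ ℚ.∣ seq x n ∣

fromℚ : ℚ → ℝ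
fromℚ p = real (λ _ → p) (Rational.const-cauchy p)

_+_ _*_ : ℝ → ℝ → ℝ
x + y = real (λ n → seq x n ℚ.+ seq y n) (Rational.+-cauchy {seq x} {seq y} (cauchy x) (cauchy y))
x * y = real (λ n → seq x n ℚ.* seq y n) (Rational.*-cauchy {seq x} {seq y} (cauchy x) (cauchy y))

-_ : ℝ → ℝ
- x = real (λ n → ℚ.- seq x n) (Rational.neg-cauchy {seq x} (cauchy x))

_-_ : ℝ → ℝ → ℝ
x - y = x + (- y)

-- The underlying sequence of the reciprocal does not depend on the apartness proof; `inv 0 = 0`
-- only affects the finitely many terms preceding the bound that the proof provides.
_⁻¹[_] : (x : ℝ) → x #0 → ℝ
x ⁻¹[ δ , 0<δ , N , away ] = real (λ n → inv (seq x n)) (Rational.inv-cauchy {seq x} δ N 0<δ away (cauchy x))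

_² : ℝ → ℝ
x ² = x * x

-- The n-th approximation of sin x is the n-th Taylor polynomial at the n-th approximation of x.
-- Taylor polynomials converge uniformly on bounded sets, so this diagonal has the right limit.
sin cos : ℝ → ℝ
sin x = real (λ n → taylor 1 n (seq x n)) (Rational.taylor-cauchy 1 {seq x} (cauchy x))
cos x = real (λ n → taylor 0 n (seq x n)) (Rational.taylor-cauchy 0 {seq x} (cauchy x))

csc cot : (x : ℝ) → sin x #0 → ℝ
csc x s = sin x ⁻¹[ s ]
cot x s = cos x * sin x ⁻¹[ s ]

-- The iteration z ↦ z + cos z converges to the only zero of the cosine in [1 , 9/5].
π/2 : ℝ
π/2 = real Rational.π/2-approx Rational.π/2-cauchy

π : ℝ
π = fromℚ (ι 2) * π/2

cos-π/2 : cos π/2 ≃ fromℚ 0ℚ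
cos-π/2 ε 0<ε =
  let N , null = Rational.cos-π/2-null ε 0<ε
  in N , λ n N≤n → subst (λ p → ℚ.∣ p ∣ ℚ.< ε) (sym (ℚₚ.+-identityʳ (seq (cos π/2) n))) (null n N≤n)

infix 8 _π/_ _π/[2_]

_π/_ : ℕ → (b : ℕ) → .{{_ : ℕ.NonZero b}} → ℝ
a π/ b = fromℚ (+ a / b) * π

_π/[2_] : ℕ → (n : ℕ) → .{{_ : ℕ.NonZero n}} → ℝ
a π/[2 n ] = (a π/ (2 ℕ.* n)) {{ℕₚ.m*n≢0 2 n}}

∑[1≤l≤_] : (m : ℕ) → (∀ l → 1 ≤ l → l ≤ m → ℝ) → ℝ
∑[1≤l≤ zero  ] f = fromℚ 0ℚ
∑[1≤l≤ suc m ] f = ∑[1≤l≤ m ] (λ l 1≤l l≤m → f l 1≤l (ℕₚ.m≤n⇒m≤1+n l≤m)) + f (suc m) (s≤s z≤n) ℕₚ.≤-refl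

-- The points πa/b lying in (0 , π), where the cosecant and the cotangent are defined.
SineNonvanishing : Set
SineNonvanishing = ∀ a b → .{{_ : ℕ.NonZero b}} → 0 < a → a < b → sin (a π/ b) #0

module _ (nonvanishing : SineNonvanishing) {n : ℕ} .{{_ : ℕ.NonZero n}} where

  sin[lπ/n]#0 : ∀ {l} → 1 ≤ l → l ≤ n ∸ 1 → sin (l π/ n) #0
  sin[lπ/n]#0 {l} 1≤l l≤n-1 = nonvanishing l n 1≤l
    (subst (l <_) (ℕₚ.suc-pred n) (s≤s l≤n-1))

  sin[kπ/2n]#0 : ∀ {k} → 0 < k → k < 2 ℕ.* n → sin (k π/[2 n ]) #0
  sin[kπ/2n]#0 {k} = nonvanishing k (2 ℕ.* n) {{ℕₚ.m*n≢0 2 n}}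

  sin[[2l-1]π/2n]#0 : ∀ {l} → 1 ≤ l → l < n → sin ((2 ℕ.* l ∸ 1) π/[2 n ]) #0
  sin[[2l-1]π/2n]#0 {l} 1≤l l<n = sin[kπ/2n]#0
    (ℕₚ.m<n⇒0<n∸m (ℕₚ.*-monoʳ-≤ 2 1≤l))
    (ℕₚ.≤-<-trans (ℕₚ.m∸n≤m (2 ℕ.* l) 1) (ℕₚ.*-monoʳ-< 2 l<n))

  sin[[2ν+1]π/2n]#0 : ∀ {ν} → ν < n → sin ((2 ℕ.* ν ℕ.+ 1) π/[2 n ]) #0
  sin[[2ν+1]π/2n]#0 {ν} ν<n = sin[kπ/2n]#0 (ℕₚ.m≤n+m 1 (2 ℕ.* ν))
    (ℕₚ.≤-trans (ℕₚ.≤-reflexive (trans (cong suc (ℕₚ.+-comm (2 ℕ.* ν) 1)) (sym (ℕₚ.*-suc 2 ν)))) (ℕₚ.*-monoʳ-≤ 2 ν<n))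

  sin[π/2n]#0 : sin (1 π/[2 n ]) #0
  sin[π/2n]#0 = sin[[2ν+1]π/2n]#0 {0} (ℕₚ.n≢0⇒n>0 (ℕ.≢-nonZero⁻¹ n))

{-# OPTIONS --safe #-}
-- The Taylor coefficients of sine and cosine are the unique formal solution of u′ = - z v, v′ = z u,
-- so the addition theorem holds coefficientwise for Cauchy products. The part of a product of partial
-- sums that the Cauchy product misses tends to zero geometrically, which gives the addition theorem
-- for reals. As cos π/2 = 0, rotation by π is negation; reflecting at π/2 and bounding the sine below
-- on [0 , π/2] makes sin (aπ/b) apart from 0.
-- The key identity is ∑ₗ sin (mlπ/n) = cot (mπ/2n) for odd m, which telescopes after multiplication
-- by 2 sin (mπ/2n). Since cos (2(ν+1)x) - cos (2νx) = - 2 sin ((2ν+1)x) sin x, the difference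
-- C(ν+1) - C(ν) is -2 times such a sum; the fourth identity reduces to two such sums via
-- 2 cot x sin (νx) sin ((ν+1)x) = csc x - sin x - cos (2νx) csc x + sin ((2ν+1)x).
module Submission where

open import Data.Nat.Base as ℕ using (ℕ; zero; suc; s≤s; z≤n)
import Data.Nat.Properties as ℕₚ
import Data.Integer.Base as ℤ
import Data.Integer.Properties as ℤₚ
open import Data.Rational.Base as ℚ using (ℚ; 0ℚ; 1ℚ; ½; _/_; toℚᵘ; positive)
import Data.Rational.Properties as ℚₚ
import Data.Rational.Unnormalised.Base as ℚᵘ
import Data.Rational.Unnormalised.Properties as ℚᵘₚ
open import Data.Nat.Solver using () renaming (module +-*-Solver to ℕ-Solver)
open import Data.Integer.Solver using () renaming (module +-*-Solver to ℤ-Solver)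
open import Data.Rational.Solver using (module +-*-Solver)
open import Data.Product.Base using (∃; _,_; proj₁; proj₂; _×_; Σ-syntax)
open import Function.Base using (_∘_)
open import Relation.Nullary.Decidable using (yes; no)
open import Relation.Binary.PropositionalEquality
open import Defs using (module Rational)
open Rational using (ι; ι-suc; 1/!_; 1/!-suc; q; recip; taylor)

-- Finite sums and Cauchy products of rational sequences.

module CoefficientSequences where
  open import Data.Rational.Base using (_+_; _*_; _-_; -_; _≤_; _<_; ∣_∣)
  open import Data.Rational.Properties
  open +-*-Solver
  open Rational using (_^_; lit≤; *-mono; *-monoʳ; *-monoˡ; 0≤*; 0≤+; 0≤^; 0≤ι; 0<ι; ι-mono; ≤-diff; ^-mono; ∣monomial∣; monomial-step; 0≤monomial; 0≤1/!; archimedean; exponent-suc)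
  open ≡-Reasoning

  -- Recursion runs from the front, so that a sum unfolds in step with `conv`; `∑-snoc` gives access
  -- to the other end.
  ∑ : (ℕ → ℚ) → ℕ → ℚ
  ∑ f zero    = 0ℚ
  ∑ f (suc n) = f 0 + ∑ (f ∘ suc) n

  -- The coefficient of degree `p` in the product of two power series. Only the first factor is
  -- shifted in the recursion.
  conv : (ℕ → ℚ) → (ℕ → ℚ) → ℕ → ℚ
  conv f g zero    = f 0 * g 0
  conv f g (suc p) = f 0 * g (suc p) + conv (f ∘ suc) g p

  ∑-cong : ∀ {f g} → (∀ i → f i ≡ g i) → ∀ n → ∑ f n ≡ ∑ g n
  ∑-cong f≗g zero    = refl
  ∑-cong f≗g (suc n) = cong₂ _+_ (f≗g 0) (∑-cong (f≗g ∘ suc) n)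

  ∑-zero : ∀ {f} → (∀ i → f i ≡ 0ℚ) → ∀ n → ∑ f n ≡ 0ℚ
  ∑-zero f≗0 zero    = refl
  ∑-zero f≗0 (suc n) = cong₂ _+_ (f≗0 0) (∑-zero (f≗0 ∘ suc) n)

  ∑-snoc : ∀ f n → ∑ f (suc n) ≡ ∑ f n + f n
  ∑-snoc f zero    = +-comm (f 0) 0ℚ
  ∑-snoc f (suc n) = trans (cong (f 0 +_) (∑-snoc (f ∘ suc) n)) (sym (+-assoc (f 0) _ _))

  ∑-linear : ∀ k l f g n → ∑ (λ i → k * f i + l * g i) n ≡ k * ∑ f n + l * ∑ g n
  ∑-linear k l f g zero    = solve 2 (λ k l → con 0ℚ := k :* con 0ℚ :+ l :* con 0ℚ) refl k l
  ∑-linear k l f g (suc n) = trans (cong (k * f 0 + l * g 0 +_) (∑-linear k l (f ∘ suc) (g ∘ suc) n))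
    (solve 6 (λ k l a b c d → k :* a :+ l :* b :+ (k :* c :+ l :* d) := k :* (a :+ c) :+ l :* (b :+ d)) refl
      k l (f 0) (g 0) (∑ (f ∘ suc) n) (∑ (g ∘ suc) n))

  conv-cong : ∀ {f f′ g g′} → (∀ i → f i ≡ f′ i) → (∀ i → g i ≡ g′ i) → ∀ p → conv f g p ≡ conv f′ g′ p
  conv-cong f≗ g≗ zero    = cong₂ _*_ (f≗ 0) (g≗ 0)
  conv-cong f≗ g≗ (suc p) = cong₂ _+_ (cong₂ _*_ (f≗ 0) (g≗ (suc p))) (conv-cong (f≗ ∘ suc) g≗ p)

  conv-*ˡ : ∀ k f g p → conv (λ i → k * f i) g p ≡ k * conv f g p
  conv-*ˡ k f g zero    = *-assoc k (f 0) (g 0)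
  conv-*ˡ k f g (suc p) = trans (cong₂ _+_ (*-assoc k (f 0) (g (suc p))) (conv-*ˡ k (f ∘ suc) g p))
    (sym (*-distribˡ-+ k (f 0 * g (suc p)) (conv (f ∘ suc) g p)))

  conv-*ʳ : ∀ k f g p → conv f (λ i → k * g i) p ≡ k * conv f g p
  conv-*ʳ k f g zero    = solve 3 (λ k a b → a :* (k :* b) := k :* (a :* b)) refl k (f 0) (g 0)
  conv-*ʳ k f g (suc p) = trans (cong (f 0 * (k * g (suc p)) +_) (conv-*ʳ k (f ∘ suc) g p))
    (solve 4 (λ k a b c → a :* (k :* b) :+ k :* c := k :* (a :* b :+ c)) refl k (f 0) (g (suc p)) (conv (f ∘ suc) g p))

  conv-snoc : ∀ f g p → conv f g (suc p) ≡ conv f (g ∘ suc) p + f (suc p) * g 0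
  conv-snoc f g zero    = refl
  conv-snoc f g (suc p) = trans (cong (f 0 * g (suc (suc p)) +_) (conv-snoc (f ∘ suc) g p))
    (sym (+-assoc (f 0 * g (suc (suc p))) _ _))

  -- In each product `f i * g j` with `i + j = p` the weight splits as `w p = w i + ι j`. A general
  -- offset `w 0` is needed because the recursion of `conv` shifts `f`, and with it the weight, to
  -- `w ∘ suc`.
  conv-weight : ∀ (w : ℕ → ℚ) → (∀ i → w i ≡ w 0 + ι i) → ∀ f g p →
    w p * conv f g p ≡ conv (λ i → w i * f i) g p + conv f (λ j → ι j * g j) p
  conv-weight w w≗ f g zero    =
    solve 3 (λ w a b → w :* (a :* b) := w :* a :* b :+ a :* (con 0ℚ :* b)) refl (w 0) (f 0) (g 0)
  conv-weight w w≗ f g (suc p) = begin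
    w (suc p) * (a * b + C)                        ≡⟨ *-distribˡ-+ (w (suc p)) (a * b) C ⟩
    w (suc p) * (a * b) + w (suc p) * C            ≡⟨ cong₂ (λ s t → s * (a * b) + t) (w≗ (suc p)) (conv-weight (w ∘ suc) shifted (f ∘ suc) g p) ⟩
    (w 0 + ι (suc p)) * (a * b) + (L + R)          ≡⟨ solve 6 (λ w i a b l r → (w :+ i) :* (a :* b) :+ (l :+ r) := w :* a :* b :+ l :+ (a :* (i :* b) :+ r)) refl (w 0) (ι (suc p)) a b L R ⟩
    w 0 * a * b + L + (a * (ι (suc p) * b) + R)    ∎
    where
      a b C L R : ℚ
      a = f 0
      b = g (suc p)
      C = conv (f ∘ suc) g p
      L = conv (λ i → w (suc i) * f (suc i)) g p
      R = conv (f ∘ suc) (λ j → ι j * g j) p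
      shifted : ∀ i → w (suc i) ≡ w 1 + ι i
      shifted i = begin
        w (suc i)           ≡⟨ w≗ (suc i) ⟩
        w 0 + ι (suc i)     ≡⟨ cong (w 0 +_) (ι-suc i) ⟩
        w 0 + (1ℚ + ι i)    ≡⟨ +-assoc (w 0) 1ℚ (ι i) ⟨
        w 0 + 1ℚ + ι i      ≡⟨ cong (_+ ι i) (w≗ 1) ⟨
        w 1 + ι i           ∎

  -- The Leibniz rule for formal power series, since (suc i) * f (suc i) is the i-th coefficient of f′.
  conv-deriv : ∀ {f g f′ g′} k l → (∀ i → ι (suc i) * f (suc i) ≡ k * f′ i) → (∀ i → ι (suc i) * g (suc i) ≡ l * g′ i) →
    ∀ p → ι (suc p) * conv f g (suc p) ≡ k * conv f′ g p + l * conv f g′ p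
  conv-deriv {f} {g} {f′} {g′} k l Df Dg p = begin
    ι (suc p) * conv f g (suc p)
      ≡⟨ conv-weight ι (λ i → sym (+-identityˡ (ι i))) f g (suc p) ⟩
    0ℚ * f 0 * g (suc p) + conv (λ i → ι (suc i) * f (suc i)) g p + conv f (λ j → ι j * g j) (suc p)
      -- The weights at index `0` are zero: one such term has come off at the front for `f`, and
      -- `conv-snoc` takes the one for `g` off at the back. What remains are the shifted, hence
      -- differentiated, sequences.
      ≡⟨ cong (0ℚ * f 0 * g (suc p) + conv (λ i → ι (suc i) * f (suc i)) g p +_) (conv-snoc f (λ j → ι j * g j) p) ⟩
    0ℚ * f 0 * g (suc p) + conv (λ i → ι (suc i) * f (suc i)) g p + (conv f (λ j → ι (suc j) * g (suc j)) p + f (suc p) * (0ℚ * g 0))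
      ≡⟨ cong₂ (λ s t → 0ℚ * f 0 * g (suc p) + s + (t + f (suc p) * (0ℚ * g 0)))
           (trans (conv-cong Df (λ _ → refl) p) (conv-*ˡ k f′ g p))
           (trans (conv-cong {f} (λ _ → refl) Dg p) (conv-*ʳ l f g′ p)) ⟩
    0ℚ * f 0 * g (suc p) + k * conv f′ g p + (l * conv f g′ p + f (suc p) * (0ℚ * g 0))
      ≡⟨ solve 6 (λ a b c d s t → con 0ℚ :* a :* b :+ s :+ (t :+ c :* (con 0ℚ :* d)) := s :+ t) refl
           (f 0) (g (suc p)) (f (suc p)) (g 0) (k * conv f′ g p) (l * conv f g′ p) ⟩
    k * conv f′ g p + l * conv f g′ p ∎

  -- Taylor coefficients of cosine and sine.

  cosSign sinSign : ℕ → ℚ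
  cosSign zero    = 1ℚ
  cosSign (suc p) = - sinSign p
  sinSign zero    = 0ℚ
  sinSign (suc p) = cosSign p

  -- The signs run through `1, 0, -1, 0` and `0, 1, 0, -1`. Keeping the zero coefficients indexes
  -- both series by the exponent, which makes differentiation a plain shift.
  cosCoeff sinCoeff : ℚ → ℕ → ℚ
  cosCoeff z p = cosSign p * (z ^ p * 1/! p)
  sinCoeff z p = sinSign p * (z ^ p * 1/! p)

  monomial-deriv : ∀ z p → ι (suc p) * (z ^ suc p * 1/! suc p) ≡ z * (z ^ p * 1/! p)
  monomial-deriv z p = trans
    (solve 4 (λ i z w f → i :* (z :* w :* f) := z :* (w :* (f :* i))) refl (ι (suc p)) z (z ^ p) (1/! suc p))
    (cong (λ t → z * (z ^ p * t)) (1/!-suc p))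

  cosCoeff-deriv : ∀ z p → ι (suc p) * cosCoeff z (suc p) ≡ (- z) * sinCoeff z p
  cosCoeff-deriv z p = trans
    (solve 3 (λ i s m → i :* (:- s :* m) := :- s :* (i :* m)) refl (ι (suc p)) (sinSign p) (z ^ suc p * 1/! suc p))
    (trans (cong (- sinSign p *_) (monomial-deriv z p))
      (solve 3 (λ s z m → :- s :* (z :* m) := :- z :* (s :* m)) refl (sinSign p) z (z ^ p * 1/! p)))

  sinCoeff-deriv : ∀ z p → ι (suc p) * sinCoeff z (suc p) ≡ z * cosCoeff z p
  sinCoeff-deriv z p = trans
    (solve 3 (λ i s m → i :* (s :* m) := s :* (i :* m)) refl (ι (suc p)) (cosSign p) (z ^ suc p * 1/! suc p))
    (trans (cong (cosSign p *_) (monomial-deriv z p))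
      (solve 3 (λ s z m → s :* (z :* m) := z :* (s :* m)) refl (cosSign p) z (z ^ p * 1/! p)))

  ι-cancel : ∀ p {x y} → ι (suc p) * x ≡ ι (suc p) * y → x ≡ y
  ι-cancel p {x} {y} eq = trans (sym (scaled x)) (trans (cong (r *_) eq) (scaled y))
    where
      r : ℚ
      r = proj₁ (recip (ι (suc p)) (0<ι p))
      scaled : ∀ x → r * (ι (suc p) * x) ≡ x
      scaled x = trans (sym (*-assoc r (ι (suc p)) x))
        (trans (cong (_* x) (proj₂ (proj₂ (recip (ι (suc p)) (0<ι p))))) (*-identityˡ x))

  -- Formal solutions of u′ = - z v, v′ = z u are determined by their initial values.
  coeff-unique : ∀ z (u v : ℕ → ℚ) → u 0 ≡ 1ℚ → v 0 ≡ 0ℚ →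
    (∀ p → ι (suc p) * u (suc p) ≡ (- z) * v p) → (∀ p → ι (suc p) * v (suc p) ≡ z * u p) →
    ∀ p → (u p ≡ cosCoeff z p) × (v p ≡ sinCoeff z p)
  coeff-unique z u v u0 v0 Du Dv zero    = u0 , v0
  coeff-unique z u v u0 v0 Du Dv (suc p) =
    let u≡ , v≡ = coeff-unique z u v u0 v0 Du Dv p
    in ι-cancel p (trans (Du p) (trans (cong (- z *_) v≡) (sym (cosCoeff-deriv z p))))
     , ι-cancel p (trans (Dv p) (trans (cong (z *_) u≡) (sym (sinCoeff-deriv z p))))

  -- The pair `cosCoeff z`, `- sinCoeff z` solves the system for `- z` with the same initial values,
  -- so uniqueness applies.
  coeff-parity : ∀ z p → (cosCoeff z p ≡ cosCoeff (- z) p) × (- sinCoeff z p ≡ sinCoeff (- z) p)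
  coeff-parity z = coeff-unique (- z) (cosCoeff z) (λ p → - sinCoeff z p) refl refl
    (λ p → trans (cosCoeff-deriv z p) (solve 2 (λ z s → :- z :* s := :- :- z :* :- s) refl z (sinCoeff z p)))
    (λ p → trans (solve 2 (λ i s → i :* :- s := :- (i :* s)) refl (ι (suc p)) (sinCoeff z (suc p)))
      (trans (cong -_ (sinCoeff-deriv z p)) (solve 2 (λ z c → :- (z :* c) := :- z :* c) refl z (cosCoeff z p))))

  -- By the Leibniz rule the two combinations of Cauchy products solve the system for `x + y`;
  -- uniqueness identifies them.
  coeff-+ : ∀ x y p →
    (conv (cosCoeff x) (cosCoeff y) p - conv (sinCoeff x) (sinCoeff y) p ≡ cosCoeff (x + y) p) ×
    (conv (sinCoeff x) (cosCoeff y) p + conv (cosCoeff x) (sinCoeff y) p ≡ sinCoeff (x + y) p)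
  coeff-+ x y = coeff-unique (x + y)
    (λ p → conv Cˣ Cʸ p - conv Sˣ Sʸ p) (λ p → conv Sˣ Cʸ p + conv Cˣ Sʸ p) refl refl
    (λ p → trans (*-distribˡ-- (ι (suc p)) (conv Cˣ Cʸ (suc p)) (conv Sˣ Sʸ (suc p)))
      (trans (cong₂ _-_ (conv-deriv (- x) (- y) (cosCoeff-deriv x) (cosCoeff-deriv y) p) (conv-deriv x y (sinCoeff-deriv x) (sinCoeff-deriv y) p))
        (solve 4 (λ x y a b → (:- x :* a :+ :- y :* b) :- (x :* b :+ y :* a) := :- (x :+ y) :* (a :+ b)) refl x y (conv Sˣ Cʸ p) (conv Cˣ Sʸ p))))
    (λ p → trans (*-distribˡ-+ (ι (suc p)) (conv Sˣ Cʸ (suc p)) (conv Cˣ Sʸ (suc p)))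
      (trans (cong₂ _+_ (conv-deriv x (- y) (sinCoeff-deriv x) (cosCoeff-deriv y) p) (conv-deriv (- x) y (cosCoeff-deriv x) (sinCoeff-deriv y) p))
        (solve 4 (λ x y a b → (x :* a :+ :- y :* b) :+ (:- x :* b :+ y :* a) := (x :+ y) :* (a :- b)) refl x y (conv Cˣ Cʸ p) (conv Sˣ Sʸ p))))
    where
      Cˣ Cʸ Sˣ Sʸ : ℕ → ℚ
      Cˣ = cosCoeff x
      Cʸ = cosCoeff y
      Sˣ = sinCoeff x
      Sʸ = sinCoeff y
      *-distribˡ-- : ∀ i a b → i * (a - b) ≡ i * a - i * b
      *-distribˡ-- = solve 3 (λ i a b → i :* (a :- b) := i :* a :- i :* b) refl

  -- Products of partial sums against Cauchy products.

  remainder : (ℕ → ℚ) → (ℕ → ℚ) → ℕ → ℚ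
  remainder f g n = ∑ f n * ∑ g n - ∑ (conv f g) n

  -- `remainder f g n` collects the products `f i * g j` with `i, j < n ≤ i + j`. Passing to `suc n`
  -- excludes `i = 0`; after shifting `i`, the pairs with `j < n` form the old triangle for
  -- `f ∘ suc`, and `j = n` adds a full column.
  remainder-suc : ∀ f g n → remainder f g (suc n) ≡ remainder (f ∘ suc) g n + ∑ (f ∘ suc) n * g n
  remainder-suc f g n = begin
    (f 0 + F) * ∑ g (suc n) - ∑ (conv f g) (suc n)
      ≡⟨ cong (λ t → (f 0 + F) * ∑ g (suc n) - (f 0 * g 0 + t)) split ⟩
    (f 0 + F) * ∑ g (suc n) - (f 0 * g 0 + (f 0 * G + 1ℚ * K))
      ≡⟨ solve 5 (λ a F g G K → (a :+ F) :* (g :+ G) :- (a :* g :+ (a :* G :+ con 1ℚ :* K)) := F :* (g :+ G) :- K) refl (f 0) F (g 0) G K ⟩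
    F * ∑ g (suc n) - K
      ≡⟨ cong (λ t → F * t - K) (∑-snoc g n) ⟩
    F * (∑ g n + g n) - K
      ≡⟨ solve 4 (λ F g G K → F :* (G :+ g) :- K := F :* G :- K :+ F :* g) refl F (g n) (∑ g n) K ⟩
    F * ∑ g n - K + F * g n ∎
    where
      F G K : ℚ
      F = ∑ (f ∘ suc) n
      G = ∑ (g ∘ suc) n
      K = ∑ (conv (f ∘ suc) g) n
      split : ∑ (λ p → f 0 * g (suc p) + conv (f ∘ suc) g p) n ≡ f 0 * G + 1ℚ * K
      split = trans (∑-cong (λ p → cong (f 0 * g (suc p) +_) (sym (*-identityˡ (conv (f ∘ suc) g p)))) n)
        (∑-linear (f 0) 1ℚ (g ∘ suc) (conv (f ∘ suc) g) n)

  -- Half of q, so that n * h ^ n is still dominated by q ^ n.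
  h : ℚ
  h = ℤ.+ 9 / 20

  0≤h : 0ℚ ≤ h
  0≤h = lit≤

  -- A record rather than a bare function type, so that `f` and `A` can be inferred from the
  -- evidence.
  record Geometric (f : ℕ → ℚ) (A : ℚ) : Set where
    constructor geometric
    field bound : ∀ p → ∣ f p ∣ ≤ A * h ^ p
  open Geometric

  geometric-tail : ∀ {f A} → Geometric f A → Geometric (f ∘ suc) (A * h)
  geometric-tail {A = A} F = geometric λ p → ≤-trans (bound F (suc p)) (≤-reflexive (sym (*-assoc A h (h ^ p))))

  geometric-0≤ : ∀ {f A} → Geometric f A → 0ℚ ≤ A
  geometric-0≤ {f} {A} F = ≤-trans (0≤∣p∣ (f 0)) (≤-trans (bound F 0) (≤-reflexive (*-identityʳ A)))

  -- The constant `2` reproduces itself in the induction: `A + 2 * (A * h) = (19/10) * A`, which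
  -- leaves `(1/10) * A` to spare.
  ∑-bound : ∀ {f A} → Geometric f A → ∀ n → ∣ ∑ f n ∣ ≤ ι 2 * A
  ∑-bound         F zero    = 0≤* {ι 2} lit≤ (geometric-0≤ F)
  ∑-bound {f} {A} F (suc n) = ≤-trans (∣p+q∣≤∣p∣+∣q∣ (f 0) (∑ (f ∘ suc) n))
    (≤-trans (+-mono-≤ (≤-trans (bound F 0) (≤-reflexive (*-identityʳ A))) (∑-bound (geometric-tail F) n))
      (≤-diff ((ℤ.+ 1 / 10) * A) (0≤* {ℤ.+ 1 / 10} lit≤ (geometric-0≤ F))
        (solve 1 (λ a → a :+ con (ι 2) :* (a :* con h) :+ con (ℤ.+ 1 / 10) :* a := con (ι 2) :* a) refl A)))

  -- Shifting `f` puts a factor `h` into both summands of `remainder-suc`. The added column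
  -- contributes one more copy of `2 * A * B * h ^ suc n`, which accounts for the linear factor.
  remainder-bound : ∀ {f g A B} → Geometric f A → Geometric g B →
    ∀ n → ∣ remainder f g n ∣ ≤ ι 2 * A * B * (ι n * h ^ n)
  remainder-bound {A = A} {B} F G zero    = ≤-reflexive (solve 2 (λ a b → con 0ℚ := con (ι 2) :* a :* b :* (con 0ℚ :* con 1ℚ)) refl A B)
  remainder-bound {f} {g} {A} {B} F G (suc n) = ≤-begin
    where
      F′ : Geometric (f ∘ suc) (A * h)
      F′ = geometric-tail F
      ≤-begin : ∣ remainder f g (suc n) ∣ ≤ ι 2 * A * B * (ι (suc n) * h ^ suc n)
      ≤-begin = R.begin
        ∣ remainder f g (suc n) ∣                                      R.≡⟨ cong ∣_∣ (remainder-suc f g n) ⟩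
        ∣ remainder (f ∘ suc) g n + ∑ (f ∘ suc) n * g n ∣              R.≤⟨ ∣p+q∣≤∣p∣+∣q∣ (remainder (f ∘ suc) g n) (∑ (f ∘ suc) n * g n) ⟩
        ∣ remainder (f ∘ suc) g n ∣ + ∣ ∑ (f ∘ suc) n * g n ∣          R.≡⟨ cong (∣ remainder (f ∘ suc) g n ∣ +_) (∣p*q∣≡∣p∣*∣q∣ (∑ (f ∘ suc) n) (g n)) ⟩
        ∣ remainder (f ∘ suc) g n ∣ + ∣ ∑ (f ∘ suc) n ∣ * ∣ g n ∣      R.≤⟨ +-mono-≤ (remainder-bound F′ G n)
                                                                            (*-mono (0≤* {ι 2} lit≤ (geometric-0≤ F′)) (0≤∣p∣ (g n)) (∑-bound F′ n) (bound G n)) ⟩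
        ι 2 * (A * h) * B * (ι n * h ^ n) + ι 2 * (A * h) * (B * h ^ n)  R.≡⟨ solve 4 (λ a b i w → con (ι 2) :* (a :* con h) :* b :* (i :* w) :+ con (ι 2) :* (a :* con h) :* (b :* w)
                                                                              := con (ι 2) :* a :* b :* ((con 1ℚ :+ i) :* (con h :* w))) refl A B (ι n) (h ^ n) ⟩
        ι 2 * A * B * ((1ℚ + ι n) * h ^ suc n)                         R.≡⟨ cong (λ t → ι 2 * A * B * (t * h ^ suc n)) (ι-suc n) ⟨
        ι 2 * A * B * (ι (suc n) * h ^ suc n)                          R.∎
        where module R = ≤-Reasoning

  n*h^n≤q^n : ∀ n → ι n * h ^ n ≤ q ^ n
  n*h^n≤q^n n = ≤-trans (*-monoˡ (0≤^ n 0≤h) (≤-diff {ι n} 1ℚ lit≤ (+-comm (ι n) 1ℚ))) (scaled n)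
    where
      -- Strengthened from `n` to `1 + n`: the induction starts with an equality, and as `q = 2 * h`
      -- its step only uses `2 + n ≤ 2 * (1 + n)`.
      scaled : ∀ n → (1ℚ + ι n) * h ^ n ≤ q ^ n
      scaled zero    = ≤-refl
      scaled (suc n) = ≤-trans
        (≤-diff (ι n * (h * h ^ n)) (0≤* (0≤ι n) (0≤^ (suc n) 0≤h))
          (trans (cong (λ t → (1ℚ + t) * (h * h ^ n) + ι n * (h * h ^ n)) (ι-suc n))
            (solve 2 (λ i w → (con 1ℚ :+ (con 1ℚ :+ i)) :* (con h :* w) :+ i :* (con h :* w) := con q :* ((con 1ℚ :+ i) :* w)) refl (ι n) (h ^ n))))
        (*-monoʳ {q} lit≤ (scaled n))

  -- The finitely many terms before the ratio bound sets in are absorbed into the constant one at a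
  -- time: `20/9 = 1/h` makes up for the index shift, and `v 0` covers the first term.
  eventually-geometric : ∀ P (v : ℕ → ℚ) → (∀ p → 0ℚ ≤ v p) → (∀ p → P ℕ.≤ p → v (suc p) ≤ h * v p) →
    ∃ λ A → (0ℚ ≤ A) × (∀ p → v p ≤ A * h ^ p)
  eventually-geometric zero    v 0≤v step = v 0 , 0≤v 0 , decay
    where
      decay : ∀ p → v p ≤ v 0 * h ^ p
      decay zero    = ≤-reflexive (sym (*-identityʳ (v 0)))
      decay (suc p) = ≤-trans (step p z≤n) (≤-trans (*-monoʳ 0≤h (decay p))
        (≤-reflexive (solve 2 (λ v w → con h :* (v :* w) := v :* (con h :* w)) refl (v 0) (h ^ p))))
  eventually-geometric (suc P) v 0≤v step =
    let A , 0≤A , tail = eventually-geometric P (v ∘ suc) (0≤v ∘ suc) (λ p P≤p → step (suc p) (s≤s P≤p))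
        0≤A/h = 0≤* {ℤ.+ 20 / 9} lit≤ 0≤A
    in v 0 + (ℤ.+ 20 / 9) * A , 0≤+ (0≤v 0) 0≤A/h , λ where
      zero    → ≤-diff ((ℤ.+ 20 / 9) * A) 0≤A/h (sym (*-identityʳ (v 0 + (ℤ.+ 20 / 9) * A)))
      (suc p) → ≤-trans (tail p) (≤-diff (v 0 * (h * h ^ p)) (0≤* (0≤v 0) (0≤^ (suc p) 0≤h))
        (solve 3 (λ v a w → a :* w :+ v :* (con h :* w) := (v :+ con (ℤ.+ 20 / 9) :* a) :* (con h :* w)) refl (v 0) A (h ^ p)))

  -- The ratio `ι M / suc p` of consecutive terms is at most `h` once `p` exceeds `(20/9) * ι M`,
  -- where `20/9 = 1/h`. The constant depends on `M` alone, so the bound is uniform in `z`.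
  monomial-geometric : ∀ M → ∃ λ A → ∀ z → ∣ z ∣ ≤ ι M → Geometric (λ p → z ^ p * 1/! p) A
  monomial-geometric M =
    let P , large = archimedean ((ℤ.+ 20 / 9) * ι M)
        A , 0≤A , decay = eventually-geometric P (λ p → ι M ^ p * 1/! p) (λ p → 0≤monomial p (0≤ι M))
          (λ p P≤p → monomial-step h p (0≤ι M) (≤-trans
            (≤-reflexive (solve 1 (λ m → m := con h :* (con (ℤ.+ 20 / 9) :* m)) refl (ι M)))
            (*-monoʳ 0≤h (≤-trans large (ι-mono (ℕₚ.m≤n⇒m≤1+n P≤p))))))
    in A , λ z z≤M → geometric λ p → ≤-trans (≤-reflexive (∣monomial∣ z p))
         (≤-trans (*-monoˡ (0≤1/! p) (^-mono p (0≤∣p∣ z) z≤M)) (decay p))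

  sign-bound : ∀ p → (∣ cosSign p ∣ ≤ 1ℚ) × (∣ sinSign p ∣ ≤ 1ℚ)
  sign-bound zero    = lit≤ , lit≤
  sign-bound (suc p) =
    let cos≤1 , sin≤1 = sign-bound p
    in subst (_≤ 1ℚ) (sym (∣-p∣≡∣p∣ (sinSign p))) sin≤1 , cos≤1

  signed-geometric : ∀ {f A} (σ : ℕ → ℚ) → (∀ p → ∣ σ p ∣ ≤ 1ℚ) → Geometric f A → Geometric (λ p → σ p * f p) A
  signed-geometric {f} σ σ≤1 F = geometric λ p → ≤-trans (≤-reflexive (∣p*q∣≡∣p∣*∣q∣ (σ p) (f p)))
    (≤-trans (*-monoˡ (0≤∣p∣ (f p)) (σ≤1 p)) (≤-trans (≤-reflexive (*-identityˡ ∣ f p ∣)) (bound F p)))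

  coeff-geometric : ∀ M → ∃ λ A → ∀ z → ∣ z ∣ ≤ ι M → Geometric (cosCoeff z) A × Geometric (sinCoeff z) A
  coeff-geometric M =
    let A , decay = monomial-geometric M
    in A , λ z z≤M → signed-geometric cosSign (λ p → proj₁ (sign-bound p)) (decay z z≤M)
                   , signed-geometric sinSign (λ p → proj₂ (sign-bound p)) (decay z z≤M)

  -- Taylor polynomials as partial sums of the coefficients.

  sign-even : ∀ n → (cosSign (n ℕ.+ n) ≡ (- 1ℚ) ^ n) × (sinSign (n ℕ.+ n) ≡ 0ℚ)
  sign-even zero    = refl , refl
  sign-even (suc n) =
    let c , s = sign-even n
    in trans (cong (cosSign ∘ suc) (ℕₚ.+-suc n n)) (trans (cong -_ c) (solve 1 (λ w → :- w := :- con 1ℚ :* w) refl ((- 1ℚ) ^ n)))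
     , trans (cong (sinSign ∘ suc) (ℕₚ.+-suc n n)) (cong -_ s)

  ∑-double : ∀ f n → ∑ f (suc n ℕ.+ suc n) ≡ ∑ f (n ℕ.+ n) + f (n ℕ.+ n) + f (suc (n ℕ.+ n))
  ∑-double f n = trans (cong (∑ f ∘ suc) (ℕₚ.+-suc n n))
    (trans (∑-snoc f (suc (n ℕ.+ n))) (cong (_+ f (suc (n ℕ.+ n))) (∑-snoc f (n ℕ.+ n))))

  -- The `n` terms of `taylor 0 n` sit at the even exponents below `n + n`; the coefficients at odd
  -- exponents are zero.
  taylor-cos : ∀ z n → taylor 0 n z ≡ ∑ (cosCoeff z) (n ℕ.+ n)
  taylor-cos z zero    = refl
  taylor-cos z (suc n) = trans
    (trans (cong₂ _+_ (taylor-cos z n) (cong₂ _*_ (sym (proj₁ (sign-even n))) (cong (λ p → z ^ p * 1/! p) exponent)))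
      (trans (solve 2 (λ a m → a := a :+ :- con 0ℚ :* m) refl (∑ (cosCoeff z) (n ℕ.+ n) + cosCoeff z (n ℕ.+ n)) m)
        (cong (λ t → ∑ (cosCoeff z) (n ℕ.+ n) + cosCoeff z (n ℕ.+ n) + - t * m) (sym (proj₂ (sign-even n))))))
    (sym (∑-double (cosCoeff z) n))
    where
      m : ℚ
      m = z ^ suc (n ℕ.+ n) * 1/! suc (n ℕ.+ n)
      exponent : 2 ℕ.* n ℕ.+ 0 ≡ n ℕ.+ n
      exponent = trans (ℕₚ.+-identityʳ _) (cong (n ℕ.+_) (ℕₚ.+-identityʳ n))

  taylor-sin : ∀ z n → taylor 1 n z ≡ ∑ (sinCoeff z) (n ℕ.+ n)
  taylor-sin z zero    = refl
  taylor-sin z (suc n) = trans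
    (cong₂ _+_
      (trans (taylor-sin z n) (trans (solve 2 (λ a m → a := a :+ con 0ℚ :* m) refl (∑ (sinCoeff z) (n ℕ.+ n)) m)
        (cong (λ t → ∑ (sinCoeff z) (n ℕ.+ n) + t * m) (sym (proj₂ (sign-even n))))))
      (cong₂ _*_ (sym (proj₁ (sign-even n))) (cong (λ p → z ^ p * 1/! p) exponent)))
    (sym (∑-double (sinCoeff z) n))
    where
      m : ℚ
      m = z ^ (n ℕ.+ n) * 1/! (n ℕ.+ n)
      exponent : 2 ℕ.* n ℕ.+ 1 ≡ suc (n ℕ.+ n)
      exponent = trans (ℕₚ.+-comm _ 1) (cong (λ k → suc (n ℕ.+ k)) (ℕₚ.+-identityʳ n))

  -- Replacing the coefficients of `x + y` by Cauchy products turns each error into a combination of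
  -- two remainders, whence `K` is twice their common bound. It depends only on `M`, so `x` and `y`
  -- may vary with `n`.
  addition-error : ∀ M → ∃ λ K → ∀ x y → ∣ x ∣ ≤ ι M → ∣ y ∣ ≤ ι M → ∀ n →
    (∣ taylor 0 n (x + y) - (taylor 0 n x * taylor 0 n y - taylor 1 n x * taylor 1 n y) ∣ ≤ K * q ^ (n ℕ.+ n)) ×
    (∣ taylor 1 n (x + y) - (taylor 1 n x * taylor 0 n y + taylor 0 n x * taylor 1 n y) ∣ ≤ K * q ^ (n ℕ.+ n))
  addition-error M =
    let A , decay = coeff-geometric M
        K = ι 2 * (ι 2 * A * A)
    in K , λ x y x≤M y≤M n →
      let Cˣ , Sˣ = decay x x≤M
          Cʸ , Sʸ = decay y y≤M
          c = λ z → ∑ (cosCoeff z) (n ℕ.+ n)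
          s = λ z → ∑ (sinCoeff z) (n ℕ.+ n)
          0≤A = geometric-0≤ Cˣ
          small : ∀ {f g} → Geometric f A → Geometric g A → ∣ remainder f g (n ℕ.+ n) ∣ ≤ ι 2 * A * A * q ^ (n ℕ.+ n)
          small F G = ≤-trans (remainder-bound F G (n ℕ.+ n))
            (*-monoʳ (0≤* {ι 2 * A} (0≤* {ι 2} lit≤ 0≤A) 0≤A) (n*h^n≤q^n (n ℕ.+ n)))
          double : ι 2 * A * A * q ^ (n ℕ.+ n) + ι 2 * A * A * q ^ (n ℕ.+ n) ≡ K * q ^ (n ℕ.+ n)
          double = solve 2 (λ a w → a :* w :+ a :* w := con (ι 2) :* a :* w) refl (ι 2 * A * A) (q ^ (n ℕ.+ n))
          R = λ f g → remainder f g (n ℕ.+ n)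
          V = λ f g → ∑ (conv f g) (n ℕ.+ n)
          cos-eq : c (x + y) - (c x * c y - s x * s y) ≡ R (sinCoeff x) (sinCoeff y) - R (cosCoeff x) (cosCoeff y)
          cos-eq = trans (cong (_- (c x * c y - s x * s y)) (trans
              (∑-cong (λ p → trans (sym (proj₁ (coeff-+ x y p)))
                (solve 2 (λ a b → a :- b := con 1ℚ :* a :+ :- con 1ℚ :* b) refl (conv (cosCoeff x) (cosCoeff y) p) (conv (sinCoeff x) (sinCoeff y) p))) (n ℕ.+ n))
              (∑-linear 1ℚ (- 1ℚ) (conv (cosCoeff x) (cosCoeff y)) (conv (sinCoeff x) (sinCoeff y)) (n ℕ.+ n))))
            (solve 6 (λ a b c d e f → con 1ℚ :* a :+ :- con 1ℚ :* b :- (c :* d :- e :* f) := e :* f :- b :- (c :* d :- a)) refl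
              (V (cosCoeff x) (cosCoeff y)) (V (sinCoeff x) (sinCoeff y)) (c x) (c y) (s x) (s y))
          sin-eq : s (x + y) - (s x * c y + c x * s y) ≡ - R (sinCoeff x) (cosCoeff y) - R (cosCoeff x) (sinCoeff y)
          sin-eq = trans (cong (_- (s x * c y + c x * s y)) (trans
              (∑-cong (λ p → trans (sym (proj₂ (coeff-+ x y p)))
                (solve 2 (λ a b → a :+ b := con 1ℚ :* a :+ con 1ℚ :* b) refl (conv (sinCoeff x) (cosCoeff y) p) (conv (cosCoeff x) (sinCoeff y) p))) (n ℕ.+ n))
              (∑-linear 1ℚ 1ℚ (conv (sinCoeff x) (cosCoeff y)) (conv (cosCoeff x) (sinCoeff y)) (n ℕ.+ n))))
            (solve 6 (λ a b c d e f → con 1ℚ :* a :+ con 1ℚ :* b :- (e :* d :+ c :* f) := :- (e :* d :- a) :- (c :* f :- b)) refl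
              (V (sinCoeff x) (cosCoeff y)) (V (cosCoeff x) (sinCoeff y)) (c x) (c y) (s x) (s y))
      in subst (_≤ K * q ^ (n ℕ.+ n))
           (cong ∣_∣ (trans (sym cos-eq) (sym (cong₂ _-_ (taylor-cos (x + y) n)
             (cong₂ _-_ (cong₂ _*_ (taylor-cos x n) (taylor-cos y n)) (cong₂ _*_ (taylor-sin x n) (taylor-sin y n)))))))
           (≤-trans (∣p-q∣≤∣p∣+∣q∣ (R (sinCoeff x) (sinCoeff y)) (R (cosCoeff x) (cosCoeff y)))
             (≤-trans (+-mono-≤ (small Sˣ Sʸ) (small Cˣ Cʸ)) (≤-reflexive double)))
       , subst (_≤ K * q ^ (n ℕ.+ n))
           (cong ∣_∣ (trans (sym sin-eq) (sym (cong₂ _-_ (taylor-sin (x + y) n)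
             (cong₂ _+_ (cong₂ _*_ (taylor-sin x n) (taylor-cos y n)) (cong₂ _*_ (taylor-cos x n) (taylor-sin y n)))))))
           (≤-trans (∣p-q∣≤∣p∣+∣q∣ (- R (sinCoeff x) (cosCoeff y)) (R (cosCoeff x) (sinCoeff y)))
             (≤-trans (+-mono-≤ (≤-trans (≤-reflexive (∣-p∣≡∣p∣ (R (sinCoeff x) (cosCoeff y)))) (small Sˣ Cʸ)) (small Cˣ Sʸ)) (≤-reflexive double)))

  taylor-parity : ∀ n z → (taylor 0 n (- z) ≡ taylor 0 n z) × (taylor 1 n (- z) ≡ - taylor 1 n z)
  taylor-parity n z =
      trans (taylor-cos (- z) n) (trans (∑-cong (λ p → sym (proj₁ (coeff-parity z p))) (n ℕ.+ n)) (sym (taylor-cos z n)))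
    , trans (taylor-sin (- z) n) (trans (∑-cong (λ p → trans (sym (proj₂ (coeff-parity z p)))
          -- `∑-linear` combines two sequences; the zero sequence fills the second place.
          (solve 1 (λ s → :- s := :- con 1ℚ :* s :+ con 0ℚ :* con 0ℚ) refl (sinCoeff z p))) (n ℕ.+ n))
        (trans (∑-linear (- 1ℚ) 0ℚ (sinCoeff z) (λ _ → 0ℚ) (n ℕ.+ n))
          (trans (solve 2 (λ s z → :- con 1ℚ :* s :+ con 0ℚ :* z := :- s) refl (∑ (sinCoeff z) (n ℕ.+ n)) (∑ (λ _ → 0ℚ) (n ℕ.+ n)))
            (cong -_ (sym (taylor-sin z n))))))

  coeff-at-0 : ∀ p → (cosCoeff 0ℚ (suc p) ≡ 0ℚ) × (sinCoeff 0ℚ p ≡ 0ℚ)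
  coeff-at-0 p = vanish (cosSign (suc p)) p , sin p
    where
      vanish : ∀ σ p → σ * (0ℚ * 0ℚ ^ p * 1/! suc p) ≡ 0ℚ
      vanish σ p = solve 3 (λ s w f → s :* (con 0ℚ :* w :* f) := con 0ℚ) refl σ (0ℚ ^ p) (1/! suc p)
      sin : ∀ p → sinCoeff 0ℚ p ≡ 0ℚ
      sin zero    = refl
      sin (suc p) = vanish (cosSign p) p

  taylor-at-0 : ∀ n → (taylor 0 (suc n) 0ℚ ≡ 1ℚ) × (taylor 1 n 0ℚ ≡ 0ℚ)
  taylor-at-0 n =
      trans (taylor-cos 0ℚ (suc n)) (cong (1ℚ +_) (∑-zero (λ p → proj₁ (coeff-at-0 p)) (n ℕ.+ suc n)))
    , trans (taylor-sin 0ℚ n) (∑-zero (λ p → proj₂ (coeff-at-0 p)) (n ℕ.+ n))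

-- Null sequences as equations between reals.

open import Defs
open import Data.Nat.Base using (NonZero; _≤_; _<_; _∸_)
open import Data.Nat.Properties using (≤-<-trans)
open CoefficientSequences using (addition-error; taylor-parity; taylor-at-0)
open +-*-Solver

-- Being a record, unlike _≃_, it lets Agda infer the sequence; equations between reals are then
-- proved as linear combinations of known ones, the combination being checked on approximations.
record Null (d : ℕ → ℚ) : Set where
  constructor null
  field small : ∀ ε → 0ℚ ℚ.< ε → ∃ λ N → ∀ n → N ≤ n → ℚ.∣ d n ∣ ℚ.< ε
open Null

infix 4 _≈_
_≈_ : ℝ → ℝ → Set
x ≈ y = Null (λ n → seq x n ℚ.- seq y n)

infixl 4 _⊕_
infix  5 _⊙_

_⊕_ : ∀ {d e} → Null d → Null e → Null (λ n → d n ℚ.+ e n)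
_⊕_ {d} {e} D E = null λ ε 0<ε →
  let N , D≤ = small D (½ ℚ.* ε) (Rational.0<½* 0<ε)
      M , E≤ = small E (½ ℚ.* ε) (Rational.0<½* 0<ε)
  in N ℕ.⊔ M , λ n ≤n → ℚₚ.≤-<-trans (ℚₚ.∣p+q∣≤∣p∣+∣q∣ (d n) (e n))
       (subst (ℚ.∣ d n ∣ ℚ.+ ℚ.∣ e n ∣ ℚ.<_) (Rational.half+half ε)
         (ℚₚ.+-mono-< (D≤ n (ℕₚ.m⊔n≤o⇒m≤o N M ≤n)) (E≤ n (ℕₚ.m⊔n≤o⇒n≤o N M ≤n))))

-- A Cauchy sequence is eventually bounded, so the coefficients of a linear combination may be
-- arbitrary reals such as cosecants.
_⊙_ : ∀ {d} (x : ℝ) → Null d → Null (λ n → seq x n ℚ.* d n)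
_⊙_ {d} x D = null λ ε 0<ε →
  let M , N , bounded = Rational.eventually-bounded {seq x} (cauchy x)
      b = ι (suc M)
      r , 0<r , r*b≡1 = Rational.recip b (Rational.0<ι M)
      K , D≤ = small D (ε ℚ.* r) (Rational.0<* 0<ε 0<r)
  in N ℕ.⊔ K , λ n ≤n → let open ℚₚ.≤-Reasoning in begin-strict
    ℚ.∣ seq x n ℚ.* d n ∣           ≡⟨ ℚₚ.∣p*q∣≡∣p∣*∣q∣ (seq x n) (d n) ⟩
    ℚ.∣ seq x n ∣ ℚ.* ℚ.∣ d n ∣     ≤⟨ Rational.*-monoˡ (ℚₚ.0≤∣p∣ (d n)) (ℚₚ.≤-trans (bounded n (ℕₚ.m⊔n≤o⇒m≤o N K ≤n)) (Rational.ι-mono (ℕₚ.n≤1+n M))) ⟩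
    b ℚ.* ℚ.∣ d n ∣                 <⟨ ℚₚ.*-monoʳ-<-pos b {{positive (Rational.0<ι M)}} (D≤ n (ℕₚ.m⊔n≤o⇒n≤o N K ≤n)) ⟩
    b ℚ.* (ε ℚ.* r)                 ≡⟨ solve 3 (λ b e r → b :* (e :* r) := e :* (r :* b)) refl b ε r ⟩
    ε ℚ.* (r ℚ.* b)                 ≡⟨ cong (ε ℚ.*_) r*b≡1 ⟩
    ε ℚ.* 1ℚ                        ≡⟨ ℚₚ.*-identityʳ ε ⟩
    ε                               ∎

infix 3 _by_
_by_ : ∀ {d e} → Null d → (∀ n → e n ≡ d n) → Null e
D by e≗d = null λ ε 0<ε →
  let N , D≤ = small D ε 0<ε
  in N , λ n N≤n → subst (λ t → ℚ.∣ t ∣ ℚ.< ε) (sym (e≗d n)) (D≤ n N≤n)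

eventually-null : ∀ {d} N → (∀ n → N ≤ n → d n ≡ 0ℚ) → Null d
eventually-null N d≡0 = null λ ε 0<ε → N , λ n N≤n → subst (λ t → ℚ.∣ t ∣ ℚ.< ε) (sym (d≡0 n N≤n)) 0<ε

geometric-null : ∀ {d} K N → (∀ n → N ≤ n → ℚ.∣ d n ∣ ℚ.≤ K ℚ.* q Rational.^ (n ℕ.+ n)) → Null d
geometric-null {d} K N d≤ = null λ ε 0<ε →
  -- The sign of `K` is unknown, hence `∣ K ∣`; halving `ε` turns the weak inequality into a strict
  -- one.
  let j , small = Rational.C*q^j-small ℚ.∣ K ∣ (½ ℚ.* ε) (ℚₚ.0≤∣p∣ K) (Rational.0<½* 0<ε)
  in N ℕ.⊔ j , λ n ≤n →
    let j≤n = ℕₚ.m⊔n≤o⇒n≤o N j ≤n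
        q^≤ = subst (λ k → q Rational.^ k ℚ.≤ q Rational.^ j) (ℕₚ.m∸n+n≡m (ℕₚ.≤-trans j≤n (ℕₚ.m≤m+n n n)))
                (Rational.q^-antitone (n ℕ.+ n ∸ j) j)
        open ℚₚ.≤-Reasoning
    in begin-strict
    ℚ.∣ d n ∣                              ≤⟨ d≤ n (ℕₚ.m⊔n≤o⇒m≤o N j ≤n) ⟩
    K ℚ.* q Rational.^ (n ℕ.+ n)           ≤⟨ Rational.*-monoˡ (Rational.0≤^ (n ℕ.+ n) Rational.0≤q) (Rational.p≤∣p∣ K) ⟩
    ℚ.∣ K ∣ ℚ.* q Rational.^ (n ℕ.+ n)     ≤⟨ Rational.*-monoʳ (ℚₚ.0≤∣p∣ K) q^≤ ⟩
    ℚ.∣ K ∣ ℚ.* q Rational.^ j             ≤⟨ small ⟩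
    ½ ℚ.* ε                                ≡⟨ ℚₚ.+-identityʳ (½ ℚ.* ε) ⟨
    ½ ℚ.* ε ℚ.+ 0ℚ                         <⟨ ℚₚ.+-monoʳ-< (½ ℚ.* ε) (Rational.0<½* 0<ε) ⟩
    ½ ℚ.* ε ℚ.+ ½ ℚ.* ε                    ≡⟨ Rational.half+half ε ⟩
    ε                                      ∎

p≡q⇒p-q≡0 : ∀ {p q} → p ≡ q → p ℚ.- q ≡ 0ℚ
p≡q⇒p-q≡0 {p} refl = ℚₚ.+-inverseʳ p

pointwise : ∀ x y → (∀ n → seq x n ≡ seq y n) → x ≈ y
pointwise x y x≗y = eventually-null 0 λ n _ → p≡q⇒p-q≡0 (x≗y n)

≈-reflexive : ∀ {x y} → x ≡ y → x ≈ y
≈-reflexive {x} refl = pointwise x x λ _ → refl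

#0-resp-≈ : ∀ {x y} → x ≈ y → x #0 → y #0
#0-resp-≈ {x} {y} x≈y (δ , 0<δ , N , away) =
  let M , close = small x≈y (½ ℚ.* δ) (Rational.0<½* 0<δ)
  in ½ ℚ.* δ , Rational.0<½* 0<δ , N ℕ.⊔ M , λ n ≤n →
    subst₂ ℚ._≤_ (cancel (½ ℚ.* δ) (½ ℚ.* δ)) (cancel (½ ℚ.* δ) ℚ.∣ seq y n ∣) (ℚₚ.+-monoʳ-≤ (ℚ.- (½ ℚ.* δ)) (let open ℚₚ.≤-Reasoning in begin
      ½ ℚ.* δ ℚ.+ ½ ℚ.* δ                             ≡⟨ Rational.half+half δ ⟩
      δ                                               ≤⟨ away n (ℕₚ.m⊔n≤o⇒m≤o N M ≤n) ⟩
      ℚ.∣ seq x n ∣                                   ≤⟨ Rational.∣p∣≤∣p-r∣+∣r∣ (seq x n) (seq y n) ⟩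
      ℚ.∣ seq x n ℚ.- seq y n ∣ ℚ.+ ℚ.∣ seq y n ∣     ≤⟨ ℚₚ.+-monoˡ-≤ ℚ.∣ seq y n ∣ (ℚₚ.<⇒≤ (close n (ℕₚ.m⊔n≤o⇒n≤o N M ≤n))) ⟩
      ½ ℚ.* δ ℚ.+ ℚ.∣ seq y n ∣                       ∎))
  where
    cancel : ∀ a b → ℚ.- a ℚ.+ (a ℚ.+ b) ≡ b
    cancel = solve 2 (λ a b → :- a :+ (a :+ b) := b) refl

-- From `N` on the terms are nonzero and their products with the inverses are exactly `1`.
⁻¹-inverseʳ : ∀ x (x#0 : x #0) → x * x ⁻¹[ x#0 ] ≈ fromℚ 1ℚ
⁻¹-inverseʳ x (δ , 0<δ , N , away) = eventually-null N λ n N≤n →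
  p≡q⇒p-q≡0 (Rational.*-inv (seq x n) λ x≡0 →
    ℚₚ.<-irrefl refl (ℚₚ.<-≤-trans 0<δ (subst (δ ℚ.≤_) (cong ℚ.∣_∣ x≡0) (away n N≤n))))

-- The addition theorem for reals and the half turn.

cos-≗ : ∀ {x y} → (∀ n → seq x n ≡ seq y n) → cos x ≈ cos y
cos-≗ {x} {y} x≗y = pointwise (cos x) (cos y) λ n → cong (taylor 0 n) (x≗y n)

sin-≗ : ∀ {x y} → (∀ n → seq x n ≡ seq y n) → sin x ≈ sin y
sin-≗ {x} {y} x≗y = pointwise (sin x) (sin y) λ n → cong (taylor 1 n) (x≗y n)

-- From some index on the approximations of `x` and `y` share a bound, and `addition-error` makes
-- the discrepancy at index `n` at most `K * q ^ (n + n)`.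
addition : ∀ x y → (cos (x + y) ≈ cos x * cos y - sin x * sin y) × (sin (x + y) ≈ sin x * cos y + cos x * sin y)
addition x y =
  let M , N , x≤ = Rational.eventually-bounded {seq x} (cauchy x)
      L , P , y≤ = Rational.eventually-bounded {seq y} (cauchy y)
      K , error = addition-error (M ℕ.⊔ L)
      bound = λ n ≤n → error (seq x n) (seq y n)
        (ℚₚ.≤-trans (x≤ n (ℕₚ.m⊔n≤o⇒m≤o N P ≤n)) (Rational.ι-mono (ℕₚ.m≤m⊔n M L)))
        (ℚₚ.≤-trans (y≤ n (ℕₚ.m⊔n≤o⇒n≤o N P ≤n)) (Rational.ι-mono (ℕₚ.m≤n⊔m M L))) n
  in geometric-null K (N ℕ.⊔ P) (λ n ≤n → proj₁ (bound n ≤n))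
   , geometric-null K (N ℕ.⊔ P) (λ n ≤n → proj₂ (bound n ≤n))

cos-≗0 : ∀ x → (∀ n → seq x n ≡ 0ℚ) → cos x ≈ fromℚ 1ℚ
-- `taylor 0 0` is the empty sum, so the value `1` is reached only from index `1` on.
cos-≗0 x x≗0 = eventually-null 1 λ where
  (suc n) _ → p≡q⇒p-q≡0 (trans (cong (taylor 0 (suc n)) (x≗0 (suc n))) (proj₁ (taylor-at-0 n)))

-- The addition theorem for `x + - x`: parity turns its right side into the sum of squares, and the
-- argument is `0` term by term.
pythagoras : ∀ x → cos x * cos x + sin x * sin x ≈ fromℚ 1ℚ
pythagoras x = fromℚ (ℚ.- 1ℚ) ⊙ proj₁ (addition x (- x)) ⊕ cos-≗0 (x + - x) (λ n → ℚₚ.+-inverseʳ (seq x n)) by λ n →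
  trans (solve 3 (λ c s d → c :* c :+ s :* s :- con 1ℚ := :- con 1ℚ :* (d :- (c :* c :- s :* :- s)) :+ (d :- con 1ℚ)) refl
          (seq (cos x) n) (seq (sin x) n) (seq (cos (x + - x)) n))
    (sym (cong₂ (λ s t → ℚ.- 1ℚ ℚ.* (seq (cos (x + - x)) n ℚ.- (seq (cos x) n ℚ.* s ℚ.- seq (sin x) n ℚ.* t)) ℚ.+ (seq (cos (x + - x)) n ℚ.- 1ℚ))
      (proj₁ (taylor-parity n (seq x n))) (proj₂ (taylor-parity n (seq x n)))))

-- With `t = π/2`, use `cos 2t = 2 cos² t - 1` and `sin 2t = 2 sin t cos t`, where `cos t` vanishes.
half-turn : (cos (π/2 + π/2) ≈ fromℚ (ℚ.- 1ℚ)) × (sin (π/2 + π/2) ≈ fromℚ 0ℚ)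
half-turn =
    (proj₁ (addition π/2 π/2) ⊕ fromℚ (ι 2) * cos π/2 ⊙ null cos-π/2 ⊕ fromℚ (ℚ.- 1ℚ) ⊙ pythagoras π/2 by λ n →
      solve 3 (λ c s d → d :- :- con 1ℚ := d :- (c :* c :- s :* s) :+ con (ι 2) :* c :* (c :- con 0ℚ) :+ :- con 1ℚ :* (c :* c :+ s :* s :- con 1ℚ)) refl
        (seq (cos π/2) n) (seq (sin π/2) n) (seq (cos (π/2 + π/2)) n))
  , (proj₂ (addition π/2 π/2) ⊕ fromℚ (ι 2) * sin π/2 ⊙ null cos-π/2 by λ n →
      solve 3 (λ c s d → d :- con 0ℚ := d :- (s :* c :+ c :* s) :+ con (ι 2) :* s :* (c :- con 0ℚ)) refl
        (seq (cos π/2) n) (seq (sin π/2) n) (seq (sin (π/2 + π/2)) n))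

-- Sines and cosines of rational multiples of `π`.

/-cross : ∀ a b c d .{{_ : NonZero b}} .{{_ : NonZero d}} → a ℕ.* d ≡ c ℕ.* b → (ℤ.+ a) / b ≡ (ℤ.+ c) / d
/-cross a (suc b) c (suc d) eq = ℚₚ.fromℚᵘ-cong {ℚᵘ.mkℚᵘ (ℤ.+ a) b} {ℚᵘ.mkℚᵘ (ℤ.+ c) d}
  (ℚᵘ.*≡* (trans (sym (ℤₚ.pos-* a (suc d))) (trans (cong ℤ.+_ eq) (ℤₚ.pos-* c (suc b)))))

/-+ : ∀ j k b .{{_ : NonZero b}} → (ℤ.+ (j ℕ.+ k)) / b ≡ (ℤ.+ j) / b ℚ.+ (ℤ.+ k) / b
/-+ j k (suc b) = ℚₚ.toℚᵘ-injective (begin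
  toℚᵘ ((ℤ.+ (j ℕ.+ k)) / suc b)                        ≈⟨ ℚₚ.toℚᵘ-fromℚᵘ (ℚᵘ.mkℚᵘ (ℤ.+ (j ℕ.+ k)) b) ⟩
  ℚᵘ.mkℚᵘ (ℤ.+ (j ℕ.+ k)) b                             ≈⟨ ℚᵘ.*≡* (ℤ-solve 3 (λ j k b → (j ⊞ k) ⊠ (b ⊠ b) ⊜ (j ⊠ b ⊞ k ⊠ b) ⊠ b) refl (ℤ.+ j) (ℤ.+ k) (ℤ.+ suc b)) ⟩
  ℚᵘ.mkℚᵘ (ℤ.+ j) b ℚᵘ.+ ℚᵘ.mkℚᵘ (ℤ.+ k) b              ≈⟨ ℚᵘₚ.+-cong (ℚₚ.toℚᵘ-fromℚᵘ (ℚᵘ.mkℚᵘ (ℤ.+ j) b)) (ℚₚ.toℚᵘ-fromℚᵘ (ℚᵘ.mkℚᵘ (ℤ.+ k) b)) ⟨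
  toℚᵘ ((ℤ.+ j) / suc b) ℚᵘ.+ toℚᵘ ((ℤ.+ k) / suc b)    ≈⟨ ℚₚ.toℚᵘ-homo-+ ((ℤ.+ j) / suc b) ((ℤ.+ k) / suc b) ⟨
  toℚᵘ ((ℤ.+ j) / suc b ℚ.+ (ℤ.+ k) / suc b)            ∎)
  where
    open ℚᵘₚ.≃-Reasoning
    open ℤ-Solver using () renaming (solve to ℤ-solve; _:+_ to _⊞_; _:*_ to _⊠_; _:=_ to _⊜_)

-- Rationals are kept in lowest terms, so the two angles are propositionally equal and can be
-- exchanged under `sin` by `cong`.
double-angle : ∀ j n .{{_ : NonZero n}} → j π/ n ≡ (2 ℕ.* j) π/[2 n ]
double-angle j n {{n≢0}} = cong (λ r → fromℚ r * π) (/-cross j n (2 ℕ.* j) (2 ℕ.* n) {{n≢0}} {{ℕₚ.m*n≢0 2 n}}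
  (trans (sym (ℕₚ.*-assoc j 2 n)) (cong (ℕ._* n) (ℕₚ.*-comm j 2))))

module Multiples (b : ℕ) .{{_ : NonZero b}} where

  c s : ℕ → ℝ
  c j = cos (j π/ b)
  s j = sin (j π/ b)

  private
    -- Angles that are rational multiples of the one sequence `π` add up term by term, as `cos-≗`
    -- and `sin-≗` require.
    +-≗ : ∀ j k n → seq ((j ℕ.+ k) π/ b) n ≡ seq (j π/ b + k π/ b) n
    +-≗ j k n = trans (cong (ℚ._* seq π n) (/-+ j k b)) (ℚₚ.*-distribʳ-+ (seq π n) ((ℤ.+ j) / b) ((ℤ.+ k) / b))

    π-≗ : ∀ n → seq (b π/ b) n ≡ seq (π/2 + π/2) n
    π-≗ n = trans (cong (ℚ._* seq π n) (/-cross b b 1 1 (ℕₚ.*-comm b 1)))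
      (solve 1 (λ p → con 1ℚ :* (con (ι 2) :* p) := p :+ p) refl (seq π/2 n))

  c-+ : ∀ j k → c (j ℕ.+ k) ≈ c j * c k - s j * s k
  c-+ j k = cos-≗ {(j ℕ.+ k) π/ b} {j π/ b + k π/ b} (+-≗ j k) ⊕ proj₁ (addition (j π/ b) (k π/ b)) by λ n →
    solve 3 (λ u v w → u :- w := u :- v :+ (v :- w)) refl
      (seq (c (j ℕ.+ k)) n) (seq (cos (j π/ b + k π/ b)) n) (seq (c j * c k - s j * s k) n)

  s-+ : ∀ j k → s (j ℕ.+ k) ≈ s j * c k + c j * s k
  s-+ j k = sin-≗ {(j ℕ.+ k) π/ b} {j π/ b + k π/ b} (+-≗ j k) ⊕ proj₂ (addition (j π/ b) (k π/ b)) by λ n →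
    solve 3 (λ u v w → u :- w := u :- v :+ (v :- w)) refl
      (seq (s (j ℕ.+ k)) n) (seq (sin (j π/ b + k π/ b)) n) (seq (s j * c k + c j * s k) n)

  c-0 : c 0 ≈ fromℚ 1ℚ
  c-0 = cos-≗0 (0 π/ b) λ n → trans (cong (ℚ._* seq π n) (ℚₚ.0/n≡0 b)) (ℚₚ.*-zeroˡ (seq π n))

  c-π : c b ≈ fromℚ (ℚ.- 1ℚ)
  c-π = cos-≗ {b π/ b} {π/2 + π/2} π-≗ ⊕ proj₁ half-turn by λ n →
    solve 2 (λ u v → u :- :- con 1ℚ := u :- v :+ (v :- :- con 1ℚ)) refl (seq (c b) n) (seq (cos (π/2 + π/2)) n)

  s-π : s b ≈ fromℚ 0ℚ
  s-π = sin-≗ {b π/ b} {π/2 + π/2} π-≗ ⊕ proj₂ half-turn by λ n →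
    solve 2 (λ u v → u :- con 0ℚ := u :- v :+ (v :- con 0ℚ)) refl (seq (s b) n) (seq (sin (π/2 + π/2)) n)

  -- The two addition formulas at `j` and `k`, solved for `c j` by Pythagoras. Angles are counted by
  -- naturals, so the difference `i - k` enters through `j + k ≡ i`.
  c-difference : ∀ {i} j k → j ℕ.+ k ≡ i → c j ≈ c i * c k + s i * s k
  c-difference j k refl =
    - c k ⊙ c-+ j k ⊕ - s k ⊙ s-+ j k ⊕ - c j ⊙ pythagoras (k π/ b) by λ n →
      solve 6 (λ cj sj ck sk c s → cj :- (c :* ck :+ s :* sk)
          := :- ck :* (c :- (cj :* ck :- sj :* sk)) :+ :- sk :* (s :- (sj :* ck :+ cj :* sk)) :+ :- cj :* (ck :* ck :+ sk :* sk :- con 1ℚ)) refl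
        (seq (c j) n) (seq (s j) n) (seq (c k) n) (seq (s k) n) (seq (c (j ℕ.+ k)) n) (seq (s (j ℕ.+ k)) n)

  s-difference : ∀ {i} j k → j ℕ.+ k ≡ i → s j ≈ s i * c k - c i * s k
  s-difference j k refl =
    s k ⊙ c-+ j k ⊕ - c k ⊙ s-+ j k ⊕ - s j ⊙ pythagoras (k π/ b) by λ n →
      solve 6 (λ cj sj ck sk c s → sj :- (s :* ck :- c :* sk)
          := sk :* (c :- (cj :* ck :- sj :* sk)) :+ :- ck :* (s :- (sj :* ck :+ cj :* sk)) :+ :- sj :* (ck :* ck :+ sk :* sk :- con 1ℚ)) refl
        (seq (c j) n) (seq (s j) n) (seq (c k) n) (seq (s k) n) (seq (c (j ℕ.+ k)) n) (seq (s (j ℕ.+ k)) n)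

  -- This is `2 sin x sin y = cos (x - y) - cos (x + y)`, the source of the telescoping and, for
  -- `j = 0`, of the double-angle formula.
  c-product : ∀ {i l} j k → j ℕ.+ k ≡ i → i ℕ.+ k ≡ l → c l ≈ c j - fromℚ (ι 2) * (s i * s k)
  c-product j k refl refl = c-+ (j ℕ.+ k) k ⊕ fromℚ (ℚ.- 1ℚ) ⊙ c-difference j k refl by λ n →
    solve 6 (λ u cj c s ck sk → u :- (cj :- con (ι 2) :* (s :* sk))
        := u :- (c :* ck :- s :* sk) :+ :- con 1ℚ :* (cj :- (c :* ck :+ s :* sk))) refl
      (seq (c (j ℕ.+ k ℕ.+ k)) n) (seq (c j) n) (seq (c (j ℕ.+ k)) n) (seq (s (j ℕ.+ k)) n) (seq (c k) n) (seq (s k) n)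

  s-reflect : ∀ j k → j ℕ.+ k ≡ b → s j ≈ s k
  s-reflect j k j+k≡b = s-difference j k j+k≡b ⊕ c k ⊙ s-π ⊕ - s k ⊙ c-π by λ n →
    solve 5 (λ sj sk ck s c → sj :- sk := sj :- (s :* ck :- c :* sk) :+ ck :* (s :- con 0ℚ) :+ :- sk :* (c :- :- con 1ℚ)) refl
      (seq (s j) n) (seq (s k) n) (seq (c k) n) (seq (s b) n) (seq (c b) n)

  odd-turn : ∀ k → (c ((2 ℕ.* k ℕ.+ 1) ℕ.* b) ≈ fromℚ (ℚ.- 1ℚ)) × (s ((2 ℕ.* k ℕ.+ 1) ℕ.* b) ≈ fromℚ 0ℚ)
  odd-turn zero    = subst (λ i → c i ≈ fromℚ (ℚ.- 1ℚ)) (sym (ℕₚ.+-identityʳ b)) c-π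
                   , subst (λ i → s i ≈ fromℚ 0ℚ) (sym (ℕₚ.+-identityʳ b)) s-π
  odd-turn (suc k) =
    let i = (2 ℕ.* k ℕ.+ 1) ℕ.* b
        ci , si = odd-turn k
        full : b ℕ.+ (b ℕ.+ i) ≡ (2 ℕ.* suc k ℕ.+ 1) ℕ.* b
        -- `(2 + 2 * k + 1) * b` reduces to `b + (b + i)`, so only `2 * suc k` has to be rewritten;
        -- the two copies of `b` are the two sign changes.
        full = cong (λ t → (t ℕ.+ 1) ℕ.* b) (sym (ℕₚ.*-suc 2 k))
    in subst (λ t → c t ≈ fromℚ (ℚ.- 1ℚ)) full
         (c-shift (b ℕ.+ i) ⊕ fromℚ (ℚ.- 1ℚ) ⊙ c-shift i ⊕ ci by λ n →
           solve 3 (λ u v w → u :- :- con 1ℚ := u :- :- v :+ :- con 1ℚ :* (v :- :- w) :+ (w :- :- con 1ℚ)) refl (seq (c (b ℕ.+ (b ℕ.+ i))) n) (seq (c (b ℕ.+ i)) n) (seq (c i) n))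
     , subst (λ t → s t ≈ fromℚ 0ℚ) full
         (s-shift (b ℕ.+ i) ⊕ fromℚ (ℚ.- 1ℚ) ⊙ s-shift i ⊕ si by λ n →
           solve 3 (λ u v w → u :- con 0ℚ := u :- :- v :+ :- con 1ℚ :* (v :- :- w) :+ (w :- con 0ℚ)) refl (seq (s (b ℕ.+ (b ℕ.+ i))) n) (seq (s (b ℕ.+ i)) n) (seq (s i) n))
    where
      c-shift : ∀ j → c (b ℕ.+ j) ≈ - c j
      c-shift j = c-+ b j ⊕ c j ⊙ c-π ⊕ - s j ⊙ s-π by λ n →
        solve 5 (λ u cb sb cj sj → u :- :- cj := u :- (cb :* cj :- sb :* sj) :+ cj :* (cb :- :- con 1ℚ) :+ :- sj :* (sb :- con 0ℚ)) refl
          (seq (c (b ℕ.+ j)) n) (seq (c b) n) (seq (s b) n) (seq (c j) n) (seq (s j) n)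
      s-shift : ∀ j → s (b ℕ.+ j) ≈ - s j
      s-shift j = s-+ b j ⊕ s j ⊙ c-π ⊕ c j ⊙ s-π by λ n →
        solve 5 (λ u cb sb cj sj → u :- :- sj := u :- (sb :* cj :+ cb :* sj) :+ sj :* (cb :- :- con 1ℚ) :+ cj :* (sb :- con 0ℚ)) refl
          (seq (s (b ℕ.+ j)) n) (seq (c b) n) (seq (s b) n) (seq (c j) n) (seq (s j) n)

-- Apartness of the sine from zero between `0` and `π`.

-- Consecutive terms of the sine series shrink by a factor of at most (9/5)²/(2·3) = 27/50.
sin-lower : ∀ {z} → 0ℚ ℚ.≤ z → z ℚ.≤ (ℤ.+ 9 / 5) → ∀ m → (ℤ.+ 23 / 50) ℚ.* z ℚ.≤ taylor 1 (suc m) z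
sin-lower {z} 0≤z z≤b m = subst (ℚ._≤ taylor 1 (suc m) z)
  (solve 1 (λ z → (con 1ℚ :- con (ℤ.+ 27 / 50)) :* (z :* con 1ℚ :* con 1ℚ) := con (ℤ.+ 23 / 50) :* z) refl z)
  (Rational.∑±-lower (ℤ.+ 27 / 50) Rational.lit≤ term (λ k → Rational.0≤monomial (2 ℕ.* k ℕ.+ 1) 0≤z) decrease m)
  where
    term : ℕ → ℚ
    term k = z Rational.^ (2 ℕ.* k ℕ.+ 1) ℚ.* Rational.1/! (2 ℕ.* k ℕ.+ 1)
    decrease : ∀ k → term (suc k) ℚ.≤ (ℤ.+ 27 / 50) ℚ.* term k
    decrease k = subst (λ p → z Rational.^ p ℚ.* Rational.1/! p ℚ.≤ (ℤ.+ 27 / 50) ℚ.* term k) (sym (Rational.exponent-suc k 1))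
      -- `9/10 = (9/5)/2` and `3/5 = (9/5)/3`; the two new factors of the factorial are at least `2`
      -- and `3`.
      (Rational.monomial-step₂ (ℤ.+ 9 / 10) (ℤ.+ 3 / 5) (2 ℕ.* k ℕ.+ 1) 0≤z Rational.lit≤ Rational.lit≤
        (≤-scaled {ℤ.+ 9 / 10} 2 Rational.lit≤ Rational.lit≤ (s≤s 1≤e))
        (≤-scaled {ℤ.+ 3 / 5} 3 Rational.lit≤ Rational.lit≤ (s≤s (s≤s 1≤e))))
      where
        1≤e : 1 ≤ 2 ℕ.* k ℕ.+ 1
        1≤e = ℕₚ.m≤n+m 1 (2 ℕ.* k)
        ≤-scaled : ∀ {r p} j → 0ℚ ℚ.≤ r → (ℤ.+ 9 / 5) ℚ.≤ r ℚ.* ι j → j ≤ p → z ℚ.≤ r ℚ.* ι p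
        ≤-scaled {r} j 0≤r b≤ j≤p = ℚₚ.≤-trans z≤b (ℚₚ.≤-trans b≤ (Rational.*-monoʳ {r} 0≤r (Rational.ι-mono j≤p)))

-- The approximations `p` of `π/2` lie in `[1 , 9/5]` and `2r ≤ 1` for `r = a/b`, so every angle
-- `z = 2r * p` satisfies `2r ≤ z ≤ 9/5`. Then `sin-lower` gives a bound independent of the index,
-- from `1` on.
sin-first-quadrant : ∀ a b .{{_ : NonZero b}} → 0 < a → 2 ℕ.* a ≤ b → sin (a π/ b) #0
sin-first-quadrant a@(suc _) b 0<a 2a≤b =
  δ , Rational.0<* {ℤ.+ 23 / 50} (ℚₚ.positive⁻¹ (ℤ.+ 23 / 50)) 0<2r , 1 , λ where
    (suc n) _ →
      let p = seq π/2 (suc n)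
          1≤p , p≤b = Rational.π/2-range (suc n)
          z = r ℚ.* (ι 2 ℚ.* p)
          z≡ : (r ℚ.+ r) ℚ.* p ≡ z
          z≡ = solve 2 (λ r p → (r :+ r) :* p := r :* (con (ι 2) :* p)) refl r p
          2r≤z = subst₂ ℚ._≤_ (ℚₚ.*-identityʳ (r ℚ.+ r)) z≡ (Rational.*-monoʳ {r ℚ.+ r} (ℚₚ.<⇒≤ 0<2r) 1≤p)
          z≤b = subst₂ ℚ._≤_ z≡ (ℚₚ.*-identityˡ (ℤ.+ 9 / 5)) (Rational.*-mono {r ℚ.+ r} {1ℚ} Rational.lit≤ (ℚₚ.≤-trans Rational.lit≤ 1≤p) 2r≤1 p≤b)
      in ℚₚ.≤-trans (Rational.*-monoʳ {ℤ.+ 23 / 50} Rational.lit≤ 2r≤z)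
           (ℚₚ.≤-trans (sin-lower (ℚₚ.≤-trans (ℚₚ.<⇒≤ 0<2r) 2r≤z) z≤b n) (Rational.p≤∣p∣ (taylor 1 (suc n) z)))
  where
    r δ : ℚ
    r = (ℤ.+ a) / b
    δ = (ℤ.+ 23 / 50) ℚ.* (r ℚ.+ r)
    0<r : 0ℚ ℚ.< r
    0<r = ℚₚ.positive⁻¹ r {{ℚₚ.normalize-pos a b}}
    0<2r : 0ℚ ℚ.< r ℚ.+ r
    0<2r = ℚₚ.+-mono-< 0<r 0<r
    2r≤1 : r ℚ.+ r ℚ.≤ 1ℚ
    2r≤1 = Rational.≤-diff ((ℤ.+ (b ∸ 2 ℕ.* a)) / b) (ℚₚ.nonNegative⁻¹ _ {{ℚₚ.normalize-nonNeg (b ∸ 2 ℕ.* a) b}}) (begin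
      r ℚ.+ r ℚ.+ (ℤ.+ (b ∸ 2 ℕ.* a)) / b             ≡⟨ cong (ℚ._+ (ℤ.+ (b ∸ 2 ℕ.* a)) / b) (/-+ a a b) ⟨
      (ℤ.+ (a ℕ.+ a)) / b ℚ.+ (ℤ.+ (b ∸ 2 ℕ.* a)) / b ≡⟨ /-+ (a ℕ.+ a) (b ∸ 2 ℕ.* a) b ⟨
      (ℤ.+ (a ℕ.+ a ℕ.+ (b ∸ 2 ℕ.* a))) / b           ≡⟨ /-cross (a ℕ.+ a ℕ.+ (b ∸ 2 ℕ.* a)) b 1 1 (trans (ℕₚ.*-identityʳ _) (trans
                                                           (cong (λ t → a ℕ.+ t ℕ.+ (b ∸ 2 ℕ.* a)) (sym (ℕₚ.+-identityʳ a)))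
                                                           (trans (ℕₚ.m+[n∸m]≡n 2a≤b) (sym (ℕₚ.*-identityˡ b))))) ⟩
      1ℚ                                              ∎)
      where open ≡-Reasoning

sine-nonvanishing : SineNonvanishing
sine-nonvanishing a b 0<a a<b with 2 ℕ.* a ℕₚ.≤? b
... | yes 2a≤b = sin-first-quadrant a b 0<a 2a≤b
... | no  2a≰b = #0-resp-≈ {sin ((b ∸ a) π/ b)} {sin (a π/ b)} (Multiples.s-reflect b (b ∸ a) a b-a+a≡b)
  (sin-first-quadrant (b ∸ a) b (ℕₚ.m<n⇒0<n∸m a<b) (begin
    2 ℕ.* (b ∸ a)           ≡⟨ ℕₚ.*-distribˡ-∸ 2 b a ⟩
    2 ℕ.* b ∸ 2 ℕ.* a       ≤⟨ ℕₚ.∸-monoʳ-≤ (2 ℕ.* b) (ℕₚ.<⇒≤ (ℕₚ.≰⇒> 2a≰b)) ⟩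
    2 ℕ.* b ∸ b             ≡⟨ ℕₚ.m+n∸m≡n b (b ℕ.+ 0) ⟩
    b ℕ.+ 0                 ≡⟨ ℕₚ.+-identityʳ b ⟩
    b                       ∎))
  where
    open ℕₚ.≤-Reasoning
    b-a+a≡b : b ∸ a ℕ.+ a ≡ b
    b-a+a≡b = ℕₚ.m∸n+n≡m (ℕₚ.<⇒≤ a<b)

-- Linear combinations of finite sums of reals.

∑-linear : ∀ m α β (f g h : ∀ l → 1 ≤ l → l ≤ m → ℝ) →
  (∀ l 1≤l l≤m → f l 1≤l l≤m ≈ fromℚ α * g l 1≤l l≤m + fromℚ β * h l 1≤l l≤m) →
  ∑[1≤l≤ m ] f ≈ fromℚ α * ∑[1≤l≤ m ] g + fromℚ β * ∑[1≤l≤ m ] h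
∑-linear zero    α β f g h f≈ = eventually-null 0 λ _ _ →
  solve 2 (λ α β → con 0ℚ :- (α :* con 0ℚ :+ β :* con 0ℚ) := con 0ℚ) refl α β
∑-linear (suc m) α β f g h f≈ =
  ∑-linear m α β (init f) (init g) (init h) (λ l 1≤l l≤m → f≈ l 1≤l (ℕₚ.m≤n⇒m≤1+n l≤m)) ⊕ f≈ (suc m) (s≤s z≤n) ℕₚ.≤-refl by λ n →
    solve 8 (λ α β F f G g H h → F :+ f :- (α :* (G :+ g) :+ β :* (H :+ h)) := F :- (α :* G :+ β :* H) :+ (f :- (α :* g :+ β :* h))) refl
      α β (seq (∑[1≤l≤ m ] (init f)) n) (seq (last f) n) (seq (∑[1≤l≤ m ] (init g)) n) (seq (last g) n) (seq (∑[1≤l≤ m ] (init h)) n) (seq (last h) n)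
  where
    init : (∀ l → 1 ≤ l → l ≤ suc m → ℝ) → ∀ l → 1 ≤ l → l ≤ m → ℝ
    init f l 1≤l l≤m = f l 1≤l (ℕₚ.m≤n⇒m≤1+n l≤m)
    last : (∀ l → 1 ≤ l → l ≤ suc m → ℝ) → ℝ
    last f = f (suc m) (s≤s z≤n) ℕₚ.≤-refl

-- Sums of sines at multiples of an angle.

module _ (n : ℕ) .{{_ : NonZero n}} where

  open ℕ-Solver using () renaming (solve to ℕ-solve; _:+_ to _⊞_; _:*_ to _⊠_; _:=_ to _⊜_; con to #)
  open Multiples n
  -- Telescoping and the cotangents take place in units of `π/2n`, whereas `s` and `c` count
  -- multiples of `π/n`.
  private module Half = Multiples (2 ℕ.* n) {{ℕₚ.m*n≢0 2 n}}

  sines : ℕ → ℝ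
  sines m = ∑[1≤l≤ n ∸ 1 ] λ l _ _ → s (m ℕ.* l)

  -- With `t = π/2n`, the `l`-th summand `2 sin (mt) sin (2mlt)` equals
  -- `cos ((2l-1)mt) - cos ((2l+1)mt)`.
  sines-partial : ∀ m L →
    fromℚ (ι 2) * (Half.s m * ∑[1≤l≤ L ] λ l _ _ → s (m ℕ.* l)) ≈ Half.c m - Half.c (m ℕ.+ 2 ℕ.* (m ℕ.* L))
  sines-partial m zero    = ≈-reflexive {Half.c (m ℕ.+ 2 ℕ.* (m ℕ.* 0))} {Half.c m} (cong Half.c (trans (cong (λ t → m ℕ.+ 2 ℕ.* t) (ℕₚ.*-zeroʳ m)) (ℕₚ.+-identityʳ m))) by λ i →
    solve 3 (λ s c c′ → con (ι 2) :* (s :* con 0ℚ) :- (c :- c′) := c′ :- c) refl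
      (seq (Half.s m) i) (seq (Half.c m) i) (seq (Half.c (m ℕ.+ 2 ℕ.* (m ℕ.* 0))) i)
  sines-partial m (suc L) = sines-partial m L
      ⊕ fromℚ (ι 2) * Half.s m ⊙ ≈-reflexive (cong sin (double-angle (m ℕ.* suc L) n))
      ⊕ Half.c-product (m ℕ.+ 2 ℕ.* (m ℕ.* L)) m step₁ step₂ by λ i →
    solve 7 (λ s P t u c e e′ → con (ι 2) :* (s :* (P :+ t)) :- (c :- e′)
        := con (ι 2) :* (s :* P) :- (c :- e) :+ con (ι 2) :* s :* (t :- u) :+ (e′ :- (e :- con (ι 2) :* (u :* s)))) refl
      (seq (Half.s m) i) (seq (∑[1≤l≤ L ] λ l _ _ → s (m ℕ.* l)) i) (seq (s (m ℕ.* suc L)) i) (seq (Half.s (2 ℕ.* (m ℕ.* suc L))) i)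
      (seq (Half.c m) i) (seq (Half.c (m ℕ.+ 2 ℕ.* (m ℕ.* L))) i) (seq (Half.c (m ℕ.+ 2 ℕ.* (m ℕ.* suc L))) i)
    where
      step₁ : m ℕ.+ 2 ℕ.* (m ℕ.* L) ℕ.+ m ≡ 2 ℕ.* (m ℕ.* suc L)
      step₁ = ℕ-solve 2 (λ m L → m ⊞ # 2 ⊠ (m ⊠ L) ⊞ m ⊜ # 2 ⊠ (m ⊠ (# 1 ⊞ L))) refl m L
      step₂ : 2 ℕ.* (m ℕ.* suc L) ℕ.+ m ≡ m ℕ.+ 2 ℕ.* (m ℕ.* suc L)
      step₂ = ℕₚ.+-comm (2 ℕ.* (m ℕ.* suc L)) m

  -- For `L = n - 1` the last telescoped angle `e` falls short of `mπ` by `mπ/2n`. Since `m` is odd,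
  -- `cos (mπ) = -1` and `sin (mπ) = 0`, so its cosine is the negative of the first one; dividing
  -- `2 cos (mπ/2n)` by `2 sin (mπ/2n)` leaves the cotangent.
  sines-odd : ∀ {m} k → m ≡ 2 ℕ.* k ℕ.+ 1 → (ap : sin (m π/[2 n ]) #0) → sines m ≈ cot (m π/[2 n ]) ap
  sines-odd {m} k refl ap = - sines m ⊙ ⁻¹-inverseʳ (sin (m π/[2 n ])) ap
      ⊕ half-inverse ⊙ sines-partial m (n ∸ 1)
      ⊕ - half-inverse ⊙ Half.c-difference e m e+m≡turns
      ⊕ - (half-inverse * Half.c m) ⊙ proj₁ (Half.odd-turn k)
      ⊕ - (half-inverse * Half.s m) ⊙ proj₂ (Half.odd-turn k) by λ i →
    solve 7 (λ T c s r e C S → T :- c :* r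
        := :- T :* (s :* r :- con 1ℚ)
           :+ con ½ :* r :* (con (ι 2) :* (s :* T) :- (c :- e))
           :+ :- (con ½ :* r) :* (e :- (C :* c :+ S :* s))
           :+ :- (con ½ :* r :* c) :* (C :- :- con 1ℚ)
           :+ :- (con ½ :* r :* s) :* (S :- con 0ℚ)) refl
      (seq (sines m) i) (seq (Half.c m) i) (seq (Half.s m) i) (seq (csc (m π/[2 n ]) ap) i) (seq (Half.c e) i)
      (seq (Half.c ((2 ℕ.* k ℕ.+ 1) ℕ.* (2 ℕ.* n))) i) (seq (Half.s ((2 ℕ.* k ℕ.+ 1) ℕ.* (2 ℕ.* n))) i)
    where
      half-inverse : ℝ
      half-inverse = fromℚ ½ * csc (m π/[2 n ]) ap
      e : ℕ
      e = m ℕ.+ 2 ℕ.* (m ℕ.* (n ∸ 1))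
      e+m≡turns : e ℕ.+ m ≡ m ℕ.* (2 ℕ.* n)
      e+m≡turns = trans
        (ℕ-solve 2 (λ m l → m ⊞ # 2 ⊠ (m ⊠ l) ⊞ m ⊜ m ⊠ (# 2 ⊠ (# 1 ⊞ l))) refl m (n ∸ 1))
        (cong (λ t → m ℕ.* (2 ℕ.* t)) (ℕₚ.suc-pred n))

  -- The four identities for the cosine-cosecant sum.

  module _ (nonvanishing : SineNonvanishing) where

    Term : Set
    Term = ∀ l → 1 ≤ l → l ≤ n ∸ 1 → ℝ

    cscᵗ : Term
    cscᵗ l 1≤l l≤n-1 = csc (l π/ n) (sin[lπ/n]#0 nonvanishing 1≤l l≤n-1)

    cosᵗ sin²ᵗ cos²ᵗ cotᵗ : ℕ → Term
    cosᵗ  ν l 1≤l l≤n-1 = cos ((2 ℕ.* ν ℕ.* l) π/ n) * cscᵗ l 1≤l l≤n-1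
    sin²ᵗ ν l 1≤l l≤n-1 = sin ((ν ℕ.* l) π/ n) ² * cscᵗ l 1≤l l≤n-1
    cos²ᵗ ν l 1≤l l≤n-1 = cos ((ν ℕ.* l) π/ n) ² * cscᵗ l 1≤l l≤n-1
    cotᵗ  ν l 1≤l l≤n-1 = cot (l π/ n) (sin[lπ/n]#0 nonvanishing 1≤l l≤n-1) * sin ((l ℕ.* ν) π/ n) * sin ((l ℕ.* (ν ℕ.+ 1)) π/ n)

    s*csc≈1 : ∀ l 1≤l l≤n-1 → s l * cscᵗ l 1≤l l≤n-1 ≈ fromℚ 1ℚ
    s*csc≈1 l 1≤l l≤n-1 = ⁻¹-inverseʳ (sin (l π/ n)) (sin[lπ/n]#0 nonvanishing 1≤l l≤n-1)

    c-double : ∀ ν l → c (2 ℕ.* ν ℕ.* l) ≈ fromℚ 1ℚ - fromℚ (ι 2) * (s (ν ℕ.* l) * s (ν ℕ.* l))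
    c-double ν l = c-product {ν ℕ.* l} 0 (ν ℕ.* l) refl
        (ℕ-solve 2 (λ ν l → ν ⊠ l ⊞ ν ⊠ l ⊜ # 2 ⊠ ν ⊠ l) refl ν l) ⊕ c-0 by λ i →
      solve 3 (λ u c s → u :- (con 1ℚ :- con (ι 2) :* (s :* s)) := u :- (c :- con (ι 2) :* (s :* s)) :+ (c :- con 1ℚ)) refl
        (seq (c (2 ℕ.* ν ℕ.* l)) i) (seq (c 0) i) (seq (s (ν ℕ.* l)) i)

    C : ℕ → ℝ
    C ν = ∑[1≤l≤ n ∸ 1 ] (cosᵗ ν)

    S : ℝ
    S = ∑[1≤l≤ n ∸ 1 ] cscᵗ

    -- Termwise `cos 2x = 1 - 2 sin² x`, multiplied by the cosecant.
    sin²-identity : ∀ ν → C ν ≈ S - fromℚ (ι 2) * ∑[1≤l≤ n ∸ 1 ] (sin²ᵗ ν)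
    sin²-identity ν = ∑-linear (n ∸ 1) 1ℚ (ℚ.- ι 2) (cosᵗ ν) cscᵗ (sin²ᵗ ν) (λ l 1≤l l≤n-1 →
        cscᵗ l 1≤l l≤n-1 ⊙ c-double ν l by λ i →
          solve 3 (λ c s r → c :* r :- (con 1ℚ :* r :+ :- con (ι 2) :* (s :* s :* r)) := r :* (c :- (con 1ℚ :- con (ι 2) :* (s :* s)))) refl
            (seq (c (2 ℕ.* ν ℕ.* l)) i) (seq (s (ν ℕ.* l)) i) (seq (cscᵗ l 1≤l l≤n-1) i)) by λ i →
      solve 3 (λ C S T → C :- (S :- con (ι 2) :* T) := C :- (con 1ℚ :* S :+ :- con (ι 2) :* T)) refl
        (seq (C ν) i) (seq S i) (seq (∑[1≤l≤ n ∸ 1 ] (sin²ᵗ ν)) i)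

    -- The same double-angle formula, with `sin²` exchanged for `cos²` by Pythagoras.
    cos²-identity : ∀ ν → C ν ≈ - S + fromℚ (ι 2) * ∑[1≤l≤ n ∸ 1 ] (cos²ᵗ ν)
    cos²-identity ν = ∑-linear (n ∸ 1) (ℚ.- 1ℚ) (ι 2) (cosᵗ ν) cscᵗ (cos²ᵗ ν) (λ l 1≤l l≤n-1 →
        cscᵗ l 1≤l l≤n-1 ⊙ c-double ν l ⊕ - (fromℚ (ι 2) * cscᵗ l 1≤l l≤n-1) ⊙ pythagoras ((ν ℕ.* l) π/ n) by λ i →
          solve 4 (λ u c s r → u :* r :- (:- con 1ℚ :* r :+ con (ι 2) :* (c :* c :* r))
              := r :* (u :- (con 1ℚ :- con (ι 2) :* (s :* s))) :+ :- (con (ι 2) :* r) :* (c :* c :+ s :* s :- con 1ℚ)) refl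
            (seq (c (2 ℕ.* ν ℕ.* l)) i) (seq (c (ν ℕ.* l)) i) (seq (s (ν ℕ.* l)) i) (seq (cscᵗ l 1≤l l≤n-1) i)) by λ i →
      solve 3 (λ C S T → C :- (:- S :+ con (ι 2) :* T) := C :- (:- con 1ℚ :* S :+ con (ι 2) :* T)) refl
        (seq (C ν) i) (seq S i) (seq (∑[1≤l≤ n ∸ 1 ] (cos²ᵗ ν)) i)

    -- Starts the induction on `ν`: `2 * 0 * l` reduces to `0`, where the cosine is `1`. A second
    -- copy of `S` with coefficient `0` fits the shape of `∑-linear`.
    C-zero : C 0 ≈ S
    C-zero = ∑-linear (n ∸ 1) 1ℚ 0ℚ (cosᵗ 0) cscᵗ cscᵗ (λ l 1≤l l≤n-1 →
        cscᵗ l 1≤l l≤n-1 ⊙ c-0 by λ i →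
          solve 2 (λ c r → c :* r :- (con 1ℚ :* r :+ con 0ℚ :* r) := r :* (c :- con 1ℚ)) refl (seq (c 0) i) (seq (cscᵗ l 1≤l l≤n-1) i)) by λ i →
      solve 2 (λ C S → C :- S := C :- (con 1ℚ :* S :+ con 0ℚ :* S)) refl (seq (C 0) i) (seq S i)

    -- The factor `sin (lπ/n)` produced by `c-product` cancels the cosecant, leaving a plain sine of
    -- an odd multiple of `lπ/n`.
    C-suc : ∀ ν → C (suc ν) ≈ C ν - fromℚ (ι 2) * sines (2 ℕ.* ν ℕ.+ 1)
    C-suc ν = ∑-linear (n ∸ 1) 1ℚ (ℚ.- ι 2) (cosᵗ (suc ν)) (cosᵗ ν) (λ l _ _ → s (m ℕ.* l)) (λ l 1≤l l≤n-1 →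
        cscᵗ l 1≤l l≤n-1 ⊙ c-product {m ℕ.* l} (2 ℕ.* ν ℕ.* l) l
            (ℕ-solve 2 (λ ν l → # 2 ⊠ ν ⊠ l ⊞ l ⊜ (# 2 ⊠ ν ⊞ # 1) ⊠ l) refl ν l)
            (ℕ-solve 2 (λ ν l → (# 2 ⊠ ν ⊞ # 1) ⊠ l ⊞ l ⊜ # 2 ⊠ (# 1 ⊞ ν) ⊠ l) refl ν l)
          ⊕ - (fromℚ (ι 2) * s (m ℕ.* l)) ⊙ s*csc≈1 l 1≤l l≤n-1 by λ i →
          solve 5 (λ u c t s r → u :* r :- (con 1ℚ :* (c :* r) :+ :- con (ι 2) :* t)
              := r :* (u :- (c :- con (ι 2) :* (t :* s))) :+ :- (con (ι 2) :* t) :* (s :* r :- con 1ℚ)) refl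
            (seq (c (2 ℕ.* suc ν ℕ.* l)) i) (seq (c (2 ℕ.* ν ℕ.* l)) i) (seq (s (m ℕ.* l)) i) (seq (s l) i) (seq (cscᵗ l 1≤l l≤n-1) i)) by λ i →
      solve 3 (λ C′ C T → C′ :- (C :- con (ι 2) :* T) := C′ :- (con 1ℚ :* C :+ :- con (ι 2) :* T)) refl
        (seq (C (suc ν)) i) (seq (C ν) i) (seq (sines m) i)
      where
        m : ℕ
        m = 2 ℕ.* ν ℕ.+ 1

    -- Induction on `ν`, each step adding one sum of sines evaluated by `sines-odd`. The apartness
    -- proofs are a parameter, so that they can be restricted along with the range.
    cot-sum-identity : ∀ ν (ap : ∀ l → 1 ≤ l → l ≤ ν → sin ((2 ℕ.* l ∸ 1) π/[2 n ]) #0) →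
      C ν ≈ S - fromℚ (ι 2) * ∑[1≤l≤ ν ] (λ l 1≤l l≤ν → cot ((2 ℕ.* l ∸ 1) π/[2 n ]) (ap l 1≤l l≤ν))
    cot-sum-identity zero    ap = C-zero by λ i →
      solve 2 (λ C S → C :- (S :- con (ι 2) :* con 0ℚ) := C :- S) refl (seq (C 0) i) (seq S i)
    cot-sum-identity (suc ν) ap = cot-sum-identity ν ap′ ⊕ C-suc ν
        -- The cotangent keeps the index `2 * suc ν ∸ 1` of the statement; only the sum of sines is
        -- moved to `2 * ν + 1`, the form in `C-suc`.
        ⊕ fromℚ (ℚ.- ι 2) ⊙ subst (λ m → sines m ≈ last) odd (sines-odd {2 ℕ.* suc ν ∸ 1} ν odd (ap (suc ν) (s≤s z≤n) ℕₚ.≤-refl)) by λ i →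
      solve 6 (λ C′ C S T D r → C′ :- (S :- con (ι 2) :* (D :+ r))
          := C :- (S :- con (ι 2) :* D) :+ (C′ :- (C :- con (ι 2) :* T)) :+ :- con (ι 2) :* (T :- r)) refl
        (seq (C (suc ν)) i) (seq (C ν) i) (seq S i) (seq (sines (2 ℕ.* ν ℕ.+ 1)) i)
        (seq (∑[1≤l≤ ν ] (λ l 1≤l l≤ν → cot ((2 ℕ.* l ∸ 1) π/[2 n ]) (ap′ l 1≤l l≤ν))) i) (seq last i)
      where
        ap′ : ∀ l → 1 ≤ l → l ≤ ν → sin ((2 ℕ.* l ∸ 1) π/[2 n ]) #0
        ap′ l 1≤l l≤ν = ap l 1≤l (ℕₚ.m≤n⇒m≤1+n l≤ν)
        last : ℝ
        last = cot ((2 ℕ.* suc ν ∸ 1) π/[2 n ]) (ap (suc ν) (s≤s z≤n) ℕₚ.≤-refl)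
        odd : 2 ℕ.* suc ν ∸ 1 ≡ 2 ℕ.* ν ℕ.+ 1
        odd = trans (cong (_∸ 1) (ℕₚ.*-suc 2 ν)) (ℕₚ.+-comm 1 (2 ℕ.* ν))

    -- With `x = lπ/n`, expand `cos (2νx)` as the cosine of `(2ν+1)x - x`, replace `cos ((2ν+1)x)`
    -- by the product formula, and use `cos² x csc x = csc x - sin x`. Writing `1 * l` matches the
    -- summand of `sines 1`.
    cot-term : ∀ ν l 1≤l l≤n-1 → cosᵗ ν l 1≤l l≤n-1 ≈
      cscᵗ l 1≤l l≤n-1 + (s ((2 ℕ.* ν ℕ.+ 1) ℕ.* l) - s (1 ℕ.* l)) - fromℚ (ι 2) * cotᵗ ν l 1≤l l≤n-1
    cot-term ν l 1≤l l≤n-1 =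
        r ⊙ c-difference {m} (2 ℕ.* ν ℕ.* l) l (ℕ-solve 2 (λ ν l → # 2 ⊠ ν ⊠ l ⊞ l ⊜ (# 2 ⊠ ν ⊞ # 1) ⊠ l) refl ν l)
      ⊕ c l * r ⊙ c-product {l ℕ.* (ν ℕ.+ 1)} {m} l (l ℕ.* ν)
          (ℕ-solve 2 (λ ν l → l ⊞ l ⊠ ν ⊜ l ⊠ (ν ⊞ # 1)) refl ν l)
          (ℕ-solve 2 (λ ν l → l ⊠ (ν ⊞ # 1) ⊞ l ⊠ ν ⊜ (# 2 ⊠ ν ⊞ # 1) ⊠ l) refl ν l)
      ⊕ r ⊙ pythagoras (l π/ n)
      ⊕ s m - s l ⊙ s*csc≈1 l 1≤l l≤n-1
      ⊕ ≈-reflexive (cong s (ℕₚ.+-identityʳ l)) by λ i →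
      solve 9 (λ cν r sm s1 cl sa sb sl cm → cν :* r :- (r :+ (sm :- s1) :- con (ι 2) :* (cl :* r :* sa :* sb))
          := r :* (cν :- (cm :* cl :+ sm :* sl))
             :+ cl :* r :* (cm :- (cl :- con (ι 2) :* (sb :* sa)))
             :+ r :* (cl :* cl :+ sl :* sl :- con 1ℚ)
             :+ (sm :- sl) :* (sl :* r :- con 1ℚ)
             :+ (s1 :- sl)) refl
        (seq (c (2 ℕ.* ν ℕ.* l)) i) (seq r i) (seq (s m) i) (seq (s (1 ℕ.* l)) i) (seq (c l) i)
        (seq (s (l ℕ.* ν)) i) (seq (s (l ℕ.* (ν ℕ.+ 1))) i) (seq (s l) i) (seq (c m) i)
      where
        r : ℝ
        r = cscᵗ l 1≤l l≤n-1
        m : ℕ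
        m = (2 ℕ.* ν ℕ.+ 1) ℕ.* l

    -- Summing `cot-term` splits off `S` and leaves `sines m - sines 1`; both are cotangents by
    -- `sines-odd`, with `k = ν` and `k = 0`.
    cot-identity : ∀ ν (ap₁ : sin (1 π/[2 n ]) #0) (ap₂ : sin ((2 ℕ.* ν ℕ.+ 1) π/[2 n ]) #0) →
      C ν ≈ S - cot (1 π/[2 n ]) ap₁ + cot ((2 ℕ.* ν ℕ.+ 1) π/[2 n ]) ap₂ - fromℚ (ι 2) * ∑[1≤l≤ n ∸ 1 ] (cotᵗ ν)
    cot-identity ν ap₁ ap₂ =
        ∑-linear (n ∸ 1) 1ℚ (ℚ.- ι 2) (cosᵗ ν) csc+sines (cotᵗ ν) (λ l 1≤l l≤n-1 → cot-term ν l 1≤l l≤n-1 by λ i →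
          solve 3 (λ f g h → f :- (con 1ℚ :* g :+ :- con (ι 2) :* h) := f :- (g :- con (ι 2) :* h)) refl
            (seq (cosᵗ ν l 1≤l l≤n-1) i) (seq (csc+sines l 1≤l l≤n-1) i) (seq (cotᵗ ν l 1≤l l≤n-1) i))
      ⊕ ∑-linear (n ∸ 1) 1ℚ 1ℚ csc+sines cscᵗ sine-difference (λ l 1≤l l≤n-1 → eventually-null 0 λ i _ →
          solve 2 (λ f g → f :+ g :- (con 1ℚ :* f :+ con 1ℚ :* g) := con 0ℚ) refl
            (seq (cscᵗ l 1≤l l≤n-1) i) (seq (sine-difference l 1≤l l≤n-1) i))
      ⊕ ∑-linear (n ∸ 1) 1ℚ (ℚ.- 1ℚ) sine-difference (λ l _ _ → s (m ℕ.* l)) (λ l _ _ → s (1 ℕ.* l)) (λ l 1≤l l≤n-1 → eventually-null 0 λ i _ →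
          solve 2 (λ f g → f :- g :- (con 1ℚ :* f :+ :- con 1ℚ :* g) := con 0ℚ) refl
            (seq (s (m ℕ.* l)) i) (seq (s (1 ℕ.* l)) i))
      ⊕ sines-odd ν refl ap₂
      ⊕ fromℚ (ℚ.- 1ℚ) ⊙ sines-odd 0 refl ap₁ by λ i →
      solve 9 (λ C V H S D T₂ T₁ r₂ r₁ → C :- (S :- r₁ :+ r₂ :- con (ι 2) :* H)
          := C :- (con 1ℚ :* V :+ :- con (ι 2) :* H)
             :+ (V :- (con 1ℚ :* S :+ con 1ℚ :* D))
             :+ (D :- (con 1ℚ :* T₂ :+ :- con 1ℚ :* T₁))
             :+ (T₂ :- r₂)
             :+ :- con 1ℚ :* (T₁ :- r₁)) refl
        (seq (C ν) i) (seq (∑[1≤l≤ n ∸ 1 ] csc+sines) i) (seq (∑[1≤l≤ n ∸ 1 ] (cotᵗ ν)) i) (seq S i)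
        (seq (∑[1≤l≤ n ∸ 1 ] sine-difference) i) (seq (sines m) i) (seq (sines 1) i)
        (seq (cot (m π/[2 n ]) ap₂) i) (seq (cot (1 π/[2 n ]) ap₁) i)
      where
        m : ℕ
        m = 2 ℕ.* ν ℕ.+ 1
        sine-difference csc+sines : Term
        sine-difference l _ _ = s (m ℕ.* l) - s (1 ℕ.* l)
        csc+sines l 1≤l l≤n-1 = cscᵗ l 1≤l l≤n-1 + sine-difference l 1≤l l≤n-1

theorem2 : ∀ (n ν : ℕ) .{{_ : NonZero n}} → 2 ≤ n → 1 ≤ ν → (ν<n : ν < n) →
  -- sin (aπ/b) is apart from 0 for 0 < a < b, which is what csc and cot need below
  Σ[ s ∈ SineNonvanishing ]
  let 2ℝ = fromℚ (Rational.ι 2)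
      C = ∑[1≤l≤ n ∸ 1 ] λ l 1≤l l≤n-1 →
            cos ((2 ℕ.* ν ℕ.* l) π/ n) * csc (l π/ n) (sin[lπ/n]#0 s 1≤l l≤n-1)
      S = ∑[1≤l≤ n ∸ 1 ] λ l 1≤l l≤n-1 →
            csc (l π/ n) (sin[lπ/n]#0 s 1≤l l≤n-1)
  in
    (C ≃ S - 2ℝ * ∑[1≤l≤ ν ] λ l 1≤l l≤ν →
           cot ((2 ℕ.* l ∸ 1) π/[2 n ]) (sin[[2l-1]π/2n]#0 s 1≤l (≤-<-trans l≤ν ν<n)))
    × (C ≃ S - 2ℝ * ∑[1≤l≤ n ∸ 1 ] λ l 1≤l l≤n-1 →
           sin ((ν ℕ.* l) π/ n) ² * csc (l π/ n) (sin[lπ/n]#0 s 1≤l l≤n-1))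
    × (C ≃ - S + 2ℝ * ∑[1≤l≤ n ∸ 1 ] λ l 1≤l l≤n-1 →
           cos ((ν ℕ.* l) π/ n) ² * csc (l π/ n) (sin[lπ/n]#0 s 1≤l l≤n-1))
    × (C ≃ S - cot (1 π/[2 n ]) (sin[π/2n]#0 s) + cot ((2 ℕ.* ν ℕ.+ 1) π/[2 n ]) (sin[[2ν+1]π/2n]#0 s ν<n)
           - 2ℝ * ∑[1≤l≤ n ∸ 1 ] λ l 1≤l l≤n-1 →
           cot (l π/ n) (sin[lπ/n]#0 s 1≤l l≤n-1) * sin ((l ℕ.* ν) π/ n) * sin ((l ℕ.* (ν ℕ.+ 1)) π/ n))
theorem2 n ν _ _ ν<n = s
  -- Projecting with `small` recovers `_≃_`, since `Null` of the difference sequence wraps exactly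
  -- its definition.
  , small (cot-sum-identity n s ν (λ l 1≤l l≤ν → sin[[2l-1]π/2n]#0 s 1≤l (≤-<-trans l≤ν ν<n)))
  , small (sin²-identity n s ν)
  , small (cos²-identity n s ν)
  , small (cot-identity n s ν (sin[π/2n]#0 s) (sin[[2ν+1]π/2n]#0 s ν<n))
  where
    s : SineNonvanishing
    s = sine-nonvanishing
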